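{- Let $\mathcal{A}$ be a separating union-closed family with base set $[n]$ and height $h$, and suppose $h = 4 \leq n$ and $0 \leq |\mathcal{B}(\mathcal{A})| \leq 2$. Then \[\mathrm{Avg}(\mathcal{A})=\frac{\sum_{A \in \mathcal{A}}|A|}{|\mathcal{A}|} \geq \frac{n}{2}.\]
   Context: A family of sets $\mathcal{A}$ is union-closed if it is a finite family of distinct finite sets with at least one nonempty member set, and $X,Y\in\mathcal{A}$ implies $X\cup Y\in\mathcal{A}$ (the empty set may be a member). For a family $\mathcal{F}$, $b(\mathcal{F})=\bigcup_{F\in\mathcal{F}}F$; the base set $b(\mathcal{A})$ is denoted $[n]=\{1,\dots,n\}$. $\mathcal{A}$ is separating if for any two distinct $x,y\in[n]$ there is $A\in\mathcal{A}$ containing exactly one of $x,y$. A chain in $\mathcal{A}$ is a subfamily any two distinct members of which are comparable under proper inclusion; the height $h$ of $\mathcal{A}$ is the maximum size of a chain in $\mathcal{A}$. For real $x\ge 0$, $\mathcal{A}_{<x}=\{A\in\mathcal{A} : |A|<x\}$. For $\mathcal{S}\subseteq\mathcal{A}$ and $S\in\mathcal{S}$, $\mathrm{irr}_{\mathcal{S}}(S)=\{s\in S : s\notin b(\mathcal{S}\setminus\{S\})\}$, and $\mathcal{S}$ is irredundant if $\mathrm{irr}_{\mathcal{S}}(S)\neq\emptyset$ for every $S\in\mathcal{S}$. Set $B=b(\mathcal{A}_{<n/2})$, and let $\mathcal{B}=\mathcal{B}(\mathcal{A})$ denote any irredundant subfamily of $\mathcal{A}_{<n/2}$ of minimum size such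 that $b(\mathcal{B})=B$ (so $|\mathcal{B}|$ is well defined). $\mathrm{Avg}(\mathcal{A})$ denotes the average size of a member set of $\mathcal{A}$. -}

module Defs where

open import Data.Bool.Properties using () renaming (_≟_ to _≟ᵇ_)
open import Data.Fin using (Fin)
open import Data.Fin.Subset using (Subset; _∈_; _∉_; _∪_; _─_; _⊂_; ⋃; ∣_∣; Nonempty; ⊤)
open import Data.Integer using (+_)
open import Data.List using (List; []; _∷_; length; map; sum; filter)
import Data.List.Membership.Propositional as List
import Data.List.Relation.Binary.Subset.Propositional as List
open import Data.List.Relation.Unary.Unique.Propositional using (Unique)
open import Data.List.Relation.Unary.Unique.Propositional.Properties using (filter⁺)
open import Data.Nat using (ℕ; NonZero; _≤_)
open import Data.Product using (∃-syntax; _×_; proj₁; proj₂)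
open import Data.Rational using (ℚ; _/_)
open import Data.Rational.Properties using (_<?_)
open import Data.Sum using (_⊎_)
open import Data.Vec.Properties using (≡-dec)
open import Level using (0ℓ)
open import Relation.Binary.Definitions using (DecidableEquality)
open import Relation.Binary.PropositionalEquality using (_≡_; _≢_)
open import Relation.Nullary.Decidable using (¬?)
open import Relation.Unary using (Pred; Decidable)

private
  variable
    n : ℕ

_≟ˢ_ : DecidableEquality (Subset n)
_≟ˢ_ = ≡-dec _≟ᵇ_

-- The ground set {1,…,n} is represented by Fin n.
record Family (n : ℕ) : Set where
  constructor family
  field
    members  : List (Subset n)
    distinct : Unique members

open Family public

infix 4 _∈ᶠ_ _⊆ᶠ_

_∈ᶠ_ : Subset n → Family n → Set
A ∈ᶠ 𝓕 = A List.∈ members 𝓕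

_⊆ᶠ_ : Family n → Family n → Set
𝓢 ⊆ᶠ 𝓐 = members 𝓢 List.⊆ members 𝓐

size : Family n → ℕ
size 𝓕 = length (members 𝓕)

b : Family n → Subset n
b 𝓕 = ⋃ (members 𝓕)

filterᶠ : {P : Pred (Subset n) 0ℓ} → Decidable P → Family n → Family n
filterᶠ P? (family As u) = family (filter P? As) (filter⁺ P? u)

record UnionClosed (𝓐 : Family n) : Set where
  field
    nonemptyMember : ∃[ A ] (A ∈ᶠ 𝓐 × Nonempty A)
    ∪-closed       : ∀ {X Y} → X ∈ᶠ 𝓐 → Y ∈ᶠ 𝓐 → (X ∪ Y) ∈ᶠ 𝓐

HasFullBase : Family n → Set
HasFullBase 𝓐 = b 𝓐 ≡ ⊤

Separating : Family n → Set
Separating {n} 𝓐 = (x y : Fin n) → x ≢ y →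
  ∃[ A ] (A ∈ᶠ 𝓐 × ((x ∈ A × y ∉ A) ⊎ (x ∉ A × y ∈ A)))

IsChain : Family n → Set
IsChain 𝓒 = ∀ {X Y} → X ∈ᶠ 𝓒 → Y ∈ᶠ 𝓒 → X ≢ Y → X ⊂ Y ⊎ Y ⊂ X

record HasHeight (𝓐 : Family n) (h : ℕ) : Set where
  field
    attained : ∃[ 𝓒 ] (𝓒 ⊆ᶠ 𝓐 × IsChain 𝓒 × size 𝓒 ≡ h)
    maximal  : ∀ 𝓒 → 𝓒 ⊆ᶠ 𝓐 → IsChain 𝓒 → size 𝓒 ≤ h

below : ℚ → Family n → Family n
below x = filterᶠ (λ A → (+ ∣ A ∣ / 1) <? x)

belowHalf : Family n → Family n
belowHalf {n} = below (+ n / 2)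

remove : Subset n → Family n → Family n
remove S = filterᶠ (λ T → ¬? (T ≟ˢ S))

irr : Family n → Subset n → Subset n
irr 𝓢 S = S ─ b (remove S 𝓢)

Irredundant : Family n → Set
Irredundant 𝓢 = ∀ {S} → S ∈ᶠ 𝓢 → Nonempty (irr 𝓢 S)

record IsIrredundantCover (𝓐 𝓢 : Family n) : Set where
  field
    subfamily   : 𝓢 ⊆ᶠ belowHalf 𝓐
    irredundant : Irredundant 𝓢
    covers      : b 𝓢 ≡ b (belowHalf 𝓐)

-- The possible choices of 𝓑(𝓐); they all have the same size.
record IsMinimumCover (𝓐 𝓑 : Family n) : Set where
  field
    isIrredundantCover : IsIrredundantCover 𝓐 𝓑
    minimum            : ∀ 𝓢 → IsIrredundantCover 𝓐 𝓢 → size 𝓑 ≤ size 𝓢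

Avg : (𝓐 : Family n) → .{{NonZero (size 𝓐)}} → ℚ
Avg 𝓐 = + sum (map ∣_∣ (members 𝓐)) / size 𝓐

UnionClosed⇒nonZero : {𝓐 : Family n} → UnionClosed 𝓐 → NonZero (size 𝓐)
UnionClosed⇒nonZero {𝓐 = family []      _} uc with () ← UnionClosed.nonemptyMember uc .proj₂ .proj₁
UnionClosed⇒nonZero {𝓐 = family (_ ∷ _) _} _ = _

{-# OPTIONS --safe #-}
module Submission where

-- Every member X has deficit n - 2|X| or surplus 2|X| - n, and the total deficit has to be at most the
-- total surplus.  Chains have at most four members, so as soon as enough of a chain is pinned down
-- above a member T, distinct members strictly below T have union T; their complements in T are then
-- disjoint, which bounds the sum of those complements by |T|.
--
-- If 𝓑 is empty, or its only set S is the only small member, ⊤ pays for everything.  If 𝓑 = {S} and S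
-- is not minimal, then for x outside S the largest member avoiding x is S or [n] - x, and by separation it is S
-- for at most one x; so there are at least |S| members of size n - 1, which pay for the sets below S.
--
-- If 𝓑 = {S, T}, then S ∪ T is not small, by minimality.  When a member lies strictly between S ∪ T
-- and [n], the packing bound alone gives total deficit at most n.  Otherwise separation forces
-- |S ∪ T| = n - 1, so S and T are disjoint of the same size s with n = 2s + 1.  For the remaining small
-- sets N, either all lie in S (or all in T), with total deficit at most 3s, or any two of them have traces
-- on S that are equal or cover S, and likewise on T.  Sets with a common trace have total deficit below 2s, and
-- either one line of equal traces or two rows contain every N, so [n] and S ∪ T pay for all of them.

open import Data.Bool using (true; false)
open import Data.Empty using () renaming (⊥ to Empty; ⊥-elim to Empty-elim)
open import Data.Fin using (Fin; zero; suc)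
import Data.Fin.Properties as Fin
open import Data.Fin.Subset using (Subset; _∈_; _∉_; _⊆_; _⊈_; _⊂_; _∪_; _∩_; _─_; _-_; ∁; ⋃; ⁅_⁆; ∣_∣; Nonempty; ⊤; ⊥)
open import Data.Fin.Subset.Properties
open import Data.Integer using (+_)
import Data.Integer as ℤ
import Data.Integer.Properties as ℤ
open import Data.List using (List; []; _∷_; _++_; length; map; filter)
import Data.List.Membership.Propositional as List
open import Data.List.Membership.Propositional.Properties using (∈-filter⁺; ∈-filter⁻; ∈-∃++; ∈-++⁺ˡ; ∈-++⁺ʳ; ∈-map⁻; ∈-length)
open import Data.List.Properties using (map-++; length-map)
open import Data.List.Relation.Binary.Permutation.Propositional.Properties using (shift; map⁺; ∈-resp-↭)
open import Data.List.Relation.Unary.All as All using (All; []; _∷_)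
open import Data.List.Relation.Unary.AllPairs as AllPairs using (AllPairs; []; _∷_)
open import Data.List.Relation.Unary.Any as Any using (here; there)
open import Data.List.Relation.Unary.Linked using ([-]; _∷_)
open import Data.List.Relation.Unary.Linked.Properties using (Linked⇒AllPairs)
open import Data.List.Relation.Unary.Unique.Propositional using (Unique)
import Data.List.Relation.Unary.Unique.Propositional.Properties as Unique
open import Data.Nat using (ℕ; zero; suc; NonZero; >-nonZero; _+_; _*_; _∸_; _≤_; _<_; z≤n; s≤s)
open import Data.Nat.ListAction using (sum)
open import Data.Nat.ListAction.Properties using (sum-++; sum-↭)
open import Data.Nat.Properties
open import Data.Nat.Tactic.RingSolver using (solve-∀)
open import Data.Product using (_×_; _,_; ∃-syntax; proj₁; proj₂)
open import Data.Rational using (_/_) renaming (_≥_ to _≥ℚ_)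
import Data.Rational as ℚ
import Data.Rational.Properties as ℚ
open import Data.Rational.Unnormalised using (mkℚᵘ; *≤*; *<*)
import Data.Rational.Unnormalised.Properties as ℚᵘ
open import Data.Sum as Sum using (_⊎_; inj₁; inj₂; [_,_]′)
open import Data.Vec using ([]; _∷_; here; there)
open import Function using (_∘_; id)
open import Relation.Binary.PropositionalEquality using (_≡_; _≢_; refl; sym; trans; cong; cong₂; subst; subst₂; ≢-sym; module ≡-Reasoning)
open import Relation.Nullary using (¬_; yes; no; contradiction)
open import Relation.Nullary.Decidable using (¬?; _×-dec_; decidable-stable)
open import Defs

private
  variable
    n : ℕ
    A : Set

-- Sums of natural numbers over lists.

≤-by : ∀ {i j} k → i + k ≡ j → i ≤ j
≤-by {i} k refl = m≤m+n i k

∑ : (A → ℕ) → List A → ℕ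
∑ f xs = sum (map f xs)

∑-++ : ∀ (f : A → ℕ) xs ys → ∑ f (xs ++ ys) ≡ ∑ f xs + ∑ f ys
∑-++ f xs ys = trans (cong sum (map-++ f xs ys)) (sum-++ (map f xs) (map f ys))

∑-mono : ∀ {f g : A → ℕ} xs → (∀ {x} → x List.∈ xs → f x ≤ g x) → ∑ f xs ≤ ∑ g xs
∑-mono []       f≤g = z≤n
∑-mono (x ∷ xs) f≤g = +-mono-≤ (f≤g (here refl)) (∑-mono xs (f≤g ∘ there))

∑-*ˡ : ∀ k (f : A → ℕ) xs → ∑ (λ x → k * f x) xs ≡ k * ∑ f xs
∑-*ˡ k f []       = sym (*-zeroʳ k)
∑-*ˡ k f (x ∷ xs) = trans (cong (_+_ (k * f x)) (∑-*ˡ k f xs)) (sym (*-distribˡ-+ k (f x) (∑ f xs)))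

∑-suc : ∀ (f : A → ℕ) xs → ∑ (suc ∘ f) xs ≡ ∑ f xs + length xs
∑-suc f []       = refl
∑-suc f (x ∷ xs) rewrite ∑-suc f xs = shuffle (f x) (∑ f xs) (length xs)
  where
  shuffle : ∀ a b c → suc (a + (b + c)) ≡ a + b + suc c
  shuffle = solve-∀

∑-const : ∀ (f : A → ℕ) k xs → (∀ {x} → x List.∈ xs → f x ≡ k) → ∑ f xs ≡ length xs * k
∑-const f k []       f≡k = refl
∑-const f k (x ∷ xs) f≡k = cong₂ _+_ (f≡k (here refl)) (∑-const f k xs (f≡k ∘ there))

-- Each entry found in `ys` claims an occurrence there, which is deleted; as `xs` has no
-- repetitions, later entries are still found in the rest. Whatever stays unclaimed only adds to the
-- right side.
∑-cover : ∀ (f : A → ℕ) {xs ys} → Unique xs → (∀ {x} → x List.∈ xs → f x ≡ 0 ⊎ x List.∈ ys) →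
  ∑ f xs ≤ ∑ f ys
∑-cover f {[]}     _        _     = z≤n
∑-cover f {x ∷ xs} {ys} (x∉xs ∷ u) cover with cover (here refl)
... | inj₁ fx≡0 rewrite fx≡0 = ∑-cover f u (cover ∘ there)
... | inj₂ x∈ys with ∈-∃++ x∈ys
... | as , bs , refl = begin
  f x + ∑ f xs         ≤⟨ +-monoʳ-≤ (f x) (∑-cover f u cover′) ⟩
  ∑ f (x ∷ as ++ bs)   ≡⟨ sum-↭ (map⁺ f (shift x as bs)) ⟨
  ∑ f (as ++ x ∷ bs)   ∎
  where
  open ≤-Reasoning
  cover′ : ∀ {y} → y List.∈ xs → f y ≡ 0 ⊎ y List.∈ (as ++ bs)
  cover′ {y} y∈xs with cover (there y∈xs)
  ... | inj₁ fy≡0 = inj₁ fy≡0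
  ... | inj₂ y∈ys with ∈-resp-↭ (shift x as bs) y∈ys
  ... | here y≡x  = contradiction (sym y≡x) (All.lookup x∉xs y∈xs)
  ... | there y∈  = inj₂ y∈

-- Finite subsets

x∈p─q⇒x∉q : ∀ {x : Fin n} (p q : Subset n) → x ∈ p ─ q → x ∉ q
x∈p─q⇒x∉q (_ ∷ p) (_ ∷ q) (there x∈) (there x∈q) = x∈p─q⇒x∉q p q x∈ x∈q
x∈p─q⇒x∉q (_ ∷ p) (true ∷ q) () here

∣p∩q∣+∣p─q∣≡∣p∣ : ∀ (p q : Subset n) → ∣ p ∩ q ∣ + ∣ p ─ q ∣ ≡ ∣ p ∣
∣p∩q∣+∣p─q∣≡∣p∣ []          []          = refl
∣p∩q∣+∣p─q∣≡∣p∣ (true ∷ p)  (true ∷ q)  = cong suc (∣p∩q∣+∣p─q∣≡∣p∣ p q)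
∣p∩q∣+∣p─q∣≡∣p∣ (true ∷ p)  (false ∷ q) = trans (+-suc _ _) (cong suc (∣p∩q∣+∣p─q∣≡∣p∣ p q))
∣p∩q∣+∣p─q∣≡∣p∣ (false ∷ p) (true ∷ q)  = ∣p∩q∣+∣p─q∣≡∣p∣ p q
∣p∩q∣+∣p─q∣≡∣p∣ (false ∷ p) (false ∷ q) = ∣p∩q∣+∣p─q∣≡∣p∣ p q

∣p∪q∣+∣p∩q∣≡∣p∣+∣q∣ : ∀ (p q : Subset n) → ∣ p ∪ q ∣ + ∣ p ∩ q ∣ ≡ ∣ p ∣ + ∣ q ∣
∣p∪q∣+∣p∩q∣≡∣p∣+∣q∣ []          []          = refl
∣p∪q∣+∣p∩q∣≡∣p∣+∣q∣ (true ∷ p)  (true ∷ q)  =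
  cong suc (trans (+-suc _ _) (trans (cong suc (∣p∪q∣+∣p∩q∣≡∣p∣+∣q∣ p q)) (sym (+-suc _ _))))
∣p∪q∣+∣p∩q∣≡∣p∣+∣q∣ (true ∷ p)  (false ∷ q) = cong suc (∣p∪q∣+∣p∩q∣≡∣p∣+∣q∣ p q)
∣p∪q∣+∣p∩q∣≡∣p∣+∣q∣ (false ∷ p) (true ∷ q)  = trans (cong suc (∣p∪q∣+∣p∩q∣≡∣p∣+∣q∣ p q)) (sym (+-suc _ _))
∣p∪q∣+∣p∩q∣≡∣p∣+∣q∣ (false ∷ p) (false ∷ q) = ∣p∪q∣+∣p∩q∣≡∣p∣+∣q∣ p q

Nonempty⇒∣p∣>0 : ∀ {p : Subset n} → Nonempty p → 1 ≤ ∣ p ∣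
Nonempty⇒∣p∣>0 {p = p} (x , x∈p) =
  subst (_≤ ∣ p ∣) (∣⁅x⁆∣≡1 x) (p⊆q⇒∣p∣≤∣q∣ λ y∈ → subst (_∈ p) (sym (x∈⁅y⁆⇒x≡y x y∈)) x∈p)

⊈⇒∃∉ : ∀ {p q : Subset n} → p ⊈ q → ∃[ x ] (x ∈ p × x ∉ q)
⊈⇒∃∉ {p = p} {q} p⊈q with Fin.any? (λ x → (x ∈? p) ×-dec ¬? (x ∈? q))
... | yes found = found
... | no  none  = contradiction (λ {x} x∈p → decidable-stable (x ∈? q) (λ x∉q → none (x , x∈p , x∉q))) p⊈q

⊆∧≢⇒⊂ : ∀ {p q : Subset n} → p ⊆ q → p ≢ q → p ⊂ q
⊆∧≢⇒⊂ p⊆q p≢q = p⊆q , ⊈⇒∃∉ λ q⊆p → p≢q (⊆-antisym p⊆q q⊆p)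

⊆∧∣≥∣⇒≡ : ∀ {p q : Subset n} → p ⊆ q → ∣ q ∣ ≤ ∣ p ∣ → p ≡ q
⊆∧∣≥∣⇒≡ {p = p} {q} p⊆q q≤p with p ≟ˢ q
... | yes p≡q = p≡q
... | no  p≢q = contradiction (p⊂q⇒∣p∣<∣q∣ (⊆∧≢⇒⊂ p⊆q p≢q)) (≤⇒≯ q≤p)

∪-lub : ∀ {p q r : Subset n} → p ⊆ r → q ⊆ r → p ∪ q ⊆ r
∪-lub {p = p} {q} p⊆r q⊆r = [ p⊆r , q⊆r ]′ ∘ x∈p∪q⁻ p q

⊆⇒∣q─p∣+∣p∣≡∣q∣ : ∀ {p q : Subset n} → p ⊆ q → ∣ q ─ p ∣ + ∣ p ∣ ≡ ∣ q ∣
⊆⇒∣q─p∣+∣p∣≡∣q∣ {p = p} {q} p⊆q = begin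
  ∣ q ─ p ∣ + ∣ p ∣      ≡⟨ +-comm ∣ q ─ p ∣ ∣ p ∣ ⟩
  ∣ p ∣ + ∣ q ─ p ∣      ≡⟨ cong (λ r → ∣ r ∣ + ∣ q ─ p ∣) (⊆-antisym (p∩q⊆q q p) (λ x∈p → x∈p∩q⁺ (p⊆q x∈p , x∈p))) ⟨
  ∣ q ∩ p ∣ + ∣ q ─ p ∣  ≡⟨ ∣p∩q∣+∣p─q∣≡∣p∣ q p ⟩
  ∣ q ∣                  ∎
  where open ≡-Reasoning

-- The complements in T of sets that pairwise cover T are disjoint.
packing : ∀ (T : Subset n) (f : A → Subset n) {xs} → Unique xs →
  (∀ {x y} → x List.∈ xs → y List.∈ xs → x ≢ y → T ⊆ f x ∪ f y) →
  ∑ (λ x → ∣ T ─ f x ∣) xs ≤ ∣ T ∣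
packing T f {[]}     _          _      = z≤n
packing T f {x ∷ xs} (x∉xs ∷ u) covers = begin
  ∣ T ─ f x ∣ + ∑ (λ y → ∣ T ─ f y ∣) xs
    ≤⟨ +-monoʳ-≤ ∣ T ─ f x ∣ (∑-mono xs λ y∈ → p⊆q⇒∣p∣≤∣q∣ (restrict y∈)) ⟩
  ∣ T ─ f x ∣ + ∑ (λ y → ∣ T ∩ f x ─ f y ∣) xs
    ≤⟨ +-monoʳ-≤ ∣ T ─ f x ∣ (packing (T ∩ f x) f u λ y∈ z∈ y≢z → covers (there y∈) (there z∈) y≢z ∘ p∩q⊆p T (f x)) ⟩
  ∣ T ─ f x ∣ + ∣ T ∩ f x ∣  ≡⟨ +-comm ∣ T ─ f x ∣ _ ⟩
  ∣ T ∩ f x ∣ + ∣ T ─ f x ∣  ≡⟨ ∣p∩q∣+∣p─q∣≡∣p∣ T (f x) ⟩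
  ∣ T ∣                      ∎
  where
  open ≤-Reasoning
  restrict : ∀ {y} → y List.∈ xs → T ─ f y ⊆ T ∩ f x ─ f y
  restrict {y} y∈ {z} z∈ with p─q⊆p T (f y) z∈ | x∈p─q⇒x∉q T (f y) z∈
  ... | z∈T | z∉fy with x∈p∪q⁻ (f x) (f y) (covers (here refl) (there y∈) (All.lookup x∉xs y∈) z∈T)
  ... | inj₁ z∈fx = x∈p∧x∉q⇒x∈p─q (x∈p∩q⁺ (z∈T , z∈fx)) z∉fy
  ... | inj₂ z∈fy = contradiction z∈fy z∉fy

elements : Subset n → List (Fin n)
elements []          = []
elements (true ∷ p)  = zero ∷ map suc (elements p)
elements (false ∷ p) = map suc (elements p)

length-elements : ∀ (p : Subset n) → length (elements p) ≡ ∣ p ∣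
length-elements []          = refl
length-elements (true ∷ p)  = cong suc (trans (length-map suc (elements p)) (length-elements p))
length-elements (false ∷ p) = trans (length-map suc (elements p)) (length-elements p)

∈-elements⁻ : ∀ {p : Subset n} {x} → x List.∈ elements p → x ∈ p
∈-elements⁻ {p = true ∷ p}  (here refl) = here
∈-elements⁻ {p = true ∷ p}  (there x∈) with ∈-map⁻ suc x∈
... | y , y∈ , refl = there (∈-elements⁻ y∈)
∈-elements⁻ {p = false ∷ p} x∈ with ∈-map⁻ suc x∈
... | y , y∈ , refl = there (∈-elements⁻ y∈)

elements-unique : ∀ (p : Subset n) → Unique (elements p)
elements-unique []          = []
elements-unique (true ∷ p)  = All.tabulate zero∉ ∷ Unique.map⁺ Fin.suc-injective (elements-unique p)
  where
  zero∉ : ∀ {x} → x List.∈ map suc (elements p) → zero ≢ x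
  zero∉ x∈ refl with ∈-map⁻ suc x∈
  ... | _ , _ , ()
elements-unique (false ∷ p) = Unique.map⁺ Fin.suc-injective (elements-unique p)

∈⋃⁻ : ∀ (Xs : List (Subset n)) {x} → x ∈ ⋃ Xs → ∃[ X ] (X List.∈ Xs × x ∈ X)
∈⋃⁻ []       x∈ = contradiction x∈ ∉⊥
∈⋃⁻ (X ∷ Xs) x∈ with x∈p∪q⁻ X (⋃ Xs) x∈
... | inj₁ x∈X = X , here refl , x∈X
... | inj₂ x∈⋃ with ∈⋃⁻ Xs x∈⋃
... | Y , Y∈ , x∈Y = Y , there Y∈ , x∈Y

∈⇒⊆⋃ : ∀ {Xs : List (Subset n)} {X} → X List.∈ Xs → X ⊆ ⋃ Xs
∈⇒⊆⋃ {Xs = X ∷ Xs} (here refl) = p⊆p∪q (⋃ Xs)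
∈⇒⊆⋃ {Xs = Y ∷ Xs} (there X∈)  = q⊆p∪q Y (⋃ Xs) ∘ ∈⇒⊆⋃ X∈

-- Deficits and surpluses relative to n / 2

deficit surplus : Subset n → ℕ
deficit {n} X = n ∸ 2 * ∣ X ∣
surplus {n} X = 2 * ∣ X ∣ ∸ n

-- For each member, `n` plus its surplus and twice its size plus its deficit are both the larger of
-- `n` and `2 * ∣ X ∣`. These equalities are summed and the total surplus is cancelled.
∑deficit≤∑surplus⇒half≤average : ∀ (Xs : List (Subset n)) → ∑ deficit Xs ≤ ∑ surplus Xs →
  n * length Xs ≤ 2 * ∑ ∣_∣ Xs
∑deficit≤∑surplus⇒half≤average {n} Xs d≤s = +-cancelʳ-≤ (∑ surplus Xs) _ _ (begin
  n * length Xs + ∑ surplus Xs     ≡⟨ balance Xs ⟩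
  2 * ∑ ∣_∣ Xs + ∑ deficit Xs      ≤⟨ +-monoʳ-≤ (2 * ∑ ∣_∣ Xs) d≤s ⟩
  2 * ∑ ∣_∣ Xs + ∑ surplus Xs      ∎)
  where
  open ≤-Reasoning
  balance₁ : ∀ i j → i + (j ∸ i) ≡ j + (i ∸ j)
  balance₁ zero    j       = sym (trans (cong (_+_ j) (0∸n≡0 j)) (+-identityʳ j))
  balance₁ (suc i) zero    = cong suc (+-identityʳ i)
  balance₁ (suc i) (suc j) = cong suc (balance₁ i j)
  balance : ∀ Ys → n * length Ys + ∑ surplus Ys ≡ 2 * ∑ ∣_∣ Ys + ∑ deficit Ys
  balance []       = trans (+-identityʳ (n * 0)) (*-zeroʳ n)
  balance (Y ∷ Ys) = begin-equality
    n * suc (length Ys) + (surplus Y + ∑ surplus Ys)     ≡⟨ shuffle₁ n (length Ys) (surplus Y) (∑ surplus Ys) ⟩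
    (n + surplus Y) + (n * length Ys + ∑ surplus Ys)     ≡⟨ cong₂ _+_ (balance₁ n (2 * ∣ Y ∣)) (balance Ys) ⟩
    (2 * ∣ Y ∣ + deficit Y) + (2 * ∑ ∣_∣ Ys + ∑ deficit Ys) ≡⟨ shuffle₂ ∣ Y ∣ (deficit Y) (∑ ∣_∣ Ys) (∑ deficit Ys) ⟩
    2 * (∣ Y ∣ + ∑ ∣_∣ Ys) + (deficit Y + ∑ deficit Ys)  ∎
    where
    shuffle₁ : ∀ n l s t → n * suc l + (s + t) ≡ (n + s) + (n * l + t)
    shuffle₁ = solve-∀
    shuffle₂ : ∀ y d t e → (2 * y + d) + (2 * t + e) ≡ 2 * (y + t) + (d + e)
    shuffle₂ = solve-∀

-- The left side is `d + 2 * c`, and `c ≥ 1` absorbs `d` into the factor. A bound proportional to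
-- the complement size `c` is what `packing` can sum.
positive-gap : ∀ {d n s} c x → c + x ≡ s → 1 ≤ c → 2 * s + d ≡ n → n ∸ 2 * x ≤ (d + 2) * c
positive-gap {d} (suc c) x refl _ refl = m≤n+o⇒m∸n≤o _ (2 * x) (≤-by (d * c) (identity d c x))
  where
  identity : ∀ d c x → 2 * (suc c + x) + d + d * c ≡ 2 * x + (d + 2) * suc c
  identity = solve-∀

-- The left side will bound the deficits of `S` and the members below it; the right side is the
-- surplus of `⊤` and `e` members of size `n - 1`. At `e = s` the difference is `2 * s * (s - 1)`.
coatoms-suffice : ∀ {d n s e} → 2 * s + d ≡ n → 1 ≤ s → s ≤ e → d + (d + 2) * s ≤ n + e * (n ∸ 2)
coatoms-suffice {d} {n} {suc s} {e} refl _ s≤e = begin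
  d + (d + 2) * suc s                      ≤⟨ ≤-by (2 * s * suc s) (identity d s) ⟩
  2 * suc s + d + suc s * (2 * s + d)      ≡⟨ cong (λ m → 2 * suc s + d + suc s * m) (minus-two s d) ⟨
  2 * suc s + d + suc s * (n ∸ 2)          ≤⟨ +-monoʳ-≤ (2 * suc s + d) (*-monoˡ-≤ (n ∸ 2) s≤e) ⟩
  2 * suc s + d + e * (n ∸ 2)              ∎
  where
  open ≤-Reasoning
  identity : ∀ d s → d + (d + 2) * suc s + 2 * s * suc s ≡ 2 * suc s + d + suc s * (2 * s + d)
  identity = solve-∀
  two : ∀ s d → 2 * suc s + d ≡ 2 + (2 * s + d)
  two = solve-∀
  minus-two : ∀ s d → 2 * suc s + d ∸ 2 ≡ 2 * s + d
  minus-two s d = cong (_∸ 2) (two s d)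

-- Since `n * x ≤ 2 * b * x`, a deficit is at most `n / b` times the complement size `c`. The
-- denominator is multiplied out to stay in `ℕ`.
proportional : ∀ {n b} c x → c + x ≡ b → n ≤ 2 * b → b * (n ∸ 2 * x) ≤ n * c
proportional {n} {b} c x refl n≤2b = begin
  b * (n ∸ 2 * x)            ≡⟨ *-distribˡ-∸ b n (2 * x) ⟩
  b * n ∸ b * (2 * x)        ≤⟨ m≤n+o⇒m∸n≤o _ (b * (2 * x)) bound ⟩
  n * c                      ∎
  where
  open ≤-Reasoning
  expand : ∀ c x n → (c + x) * n ≡ n * x + n * c
  expand = solve-∀
  swap : ∀ b x → 2 * b * x ≡ b * (2 * x)
  swap = solve-∀
  bound : b * n ≤ b * (2 * x) + n * c
  bound = begin
    (c + x) * n            ≡⟨ expand c x n ⟩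
    n * x + n * c          ≤⟨ +-monoˡ-≤ (n * c) (*-monoˡ-≤ x n≤2b) ⟩
    2 * b * x + n * c      ≡⟨ cong (λ m → m + n * c) (swap b x) ⟩
    b * (2 * x) + n * c    ∎

-- Union-closed families of height four

comparable : ∀ {Xs : List (Subset n)} → AllPairs _⊂_ Xs →
  ∀ {X Y} → X List.∈ Xs → Y List.∈ Xs → X ≢ Y → X ⊂ Y ⊎ Y ⊂ X
comparable (X⊂ ∷ _)  (here refl) (here refl) X≢X = contradiction refl X≢X
comparable (X⊂ ∷ _)  (here refl) (there Y∈)  _   = inj₁ (All.lookup X⊂ Y∈)
comparable (Y⊂ ∷ _)  (there X∈)  (here refl) _   = inj₂ (All.lookup Y⊂ X∈)
comparable (_ ∷ ps) (there X∈)  (there Y∈)  X≢Y = comparable ps X∈ Y∈ X≢Y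

Small : Subset n → Set
Small {n} X = 2 * ∣ X ∣ < n

module Height4 {n : ℕ} (𝓐 : Family n) (uc : UnionClosed 𝓐) (full : HasFullBase 𝓐)
  (sep : Separating 𝓐) (height : HasHeight 𝓐 4) where

  open UnionClosed uc

  noChain₅ : ∀ {V W X Y Z} → V ∈ᶠ 𝓐 → W ∈ᶠ 𝓐 → X ∈ᶠ 𝓐 → Y ∈ᶠ 𝓐 → Z ∈ᶠ 𝓐 →
    V ⊂ W → W ⊂ X → X ⊂ Y → Y ⊂ Z → Empty
  noChain₅ {V} {W} {X} {Y} {Z} V∈ W∈ X∈ Y∈ Z∈ V⊂W W⊂X X⊂Y Y⊂Z =
    contradiction (HasHeight.maximal height (family Xs unique) (All.lookup members∈) (comparable chain)) λ {(s≤s (s≤s (s≤s (s≤s ()))))}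
    where
    Xs : List (Subset n)
    Xs = V ∷ W ∷ X ∷ Y ∷ Z ∷ []
    chain : AllPairs _⊂_ Xs
    chain = Linked⇒AllPairs ⊂-trans (V⊂W ∷ W⊂X ∷ X⊂Y ∷ Y⊂Z ∷ [-])
    unique : Unique Xs
    unique = AllPairs.map (λ p⊂q p≡q → ⊂-irref p≡q p⊂q) chain
    members∈ : All (_∈ᶠ 𝓐) Xs
    members∈ = V∈ ∷ W∈ ∷ X∈ ∷ Y∈ ∷ Z∈ ∷ []

  -- The element `X` rules out the empty list, whose union `⊥` may fail to be a member.
  ⋃-closed : ∀ {X} (Xs : List (Subset n)) → X List.∈ Xs → (∀ {Y} → Y List.∈ Xs → Y ∈ᶠ 𝓐) → ⋃ Xs ∈ᶠ 𝓐
  ⋃-closed (Y ∷ [])     _ Xs⊆ = subst (_∈ᶠ 𝓐) (sym (∪-identityʳ Y)) (Xs⊆ (here refl))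
  ⋃-closed (Y ∷ Z ∷ Zs) _ Xs⊆ = ∪-closed (Xs⊆ (here refl)) (⋃-closed (Z ∷ Zs) (here refl) (Xs⊆ ∘ there))

  ⊤∈𝓐 : ⊤ ∈ᶠ 𝓐
  ⊤∈𝓐 = subst (_∈ᶠ 𝓐) full (⋃-closed (members 𝓐) (proj₁ (proj₂ nonemptyMember)) id)

  -- Joining `T` with a member that separates `x` from `y` adds exactly one of these two points.
  between : ∀ {T x y} → T ∈ᶠ 𝓐 → x ≢ y → x ∉ T → y ∉ T → ∃[ Z ] (Z ∈ᶠ 𝓐 × T ⊂ Z × Z ⊂ ⊤)
  between {T} {x} {y} T∈ x≢y x∉T y∉T with sep x y x≢y
  ... | A , A∈ , inj₁ (x∈A , y∉A) = T ∪ A , ∪-closed T∈ A∈ ,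
    (p⊆p∪q A , x , q⊆p∪q T A x∈A , x∉T) , (⊆⊤ , y , ∈⊤ , [ y∉T , y∉A ]′ ∘ x∈p∪q⁻ T A)
  ... | A , A∈ , inj₂ (x∉A , y∈A) = T ∪ A , ∪-closed T∈ A∈ ,
    (p⊆p∪q A , y , q⊆p∪q T A y∈A , y∉T) , (⊆⊤ , x , ∈⊤ , [ x∉T , x∉A ]′ ∘ x∈p∪q⁻ T A)

  -- As `X` and `Y` differ, `X ∪ Y` properly contains at least one of them; were it not `T`, a
  -- member would lie strictly between that one and `T`. The premise `short` forbids this and will
  -- come from the height bound.
  join : ∀ {X Y T} → X ∈ᶠ 𝓐 → Y ∈ᶠ 𝓐 → X ⊂ T → Y ⊂ T → X ≢ Y →
    (∀ {W Z} → W ≡ X ⊎ W ≡ Y → Z ∈ᶠ 𝓐 → W ⊂ Z → Z ⊂ T → Empty) → X ∪ Y ≡ T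
  join {X} {Y} {T} X∈ Y∈ X⊂T Y⊂T X≢Y short with (X ∪ Y) ≟ˢ T
  ... | yes X∪Y≡T = X∪Y≡T
  ... | no  X∪Y≢T with X ≟ˢ (X ∪ Y)
  ... | yes X≡X∪Y = Empty-elim (short (inj₂ refl) X∈
    (⊆∧≢⇒⊂ (subst (Y ⊆_) (sym X≡X∪Y) (q⊆p∪q X Y)) (≢-sym X≢Y)) X⊂T)
  ... | no  X≢X∪Y = Empty-elim (short (inj₁ refl) (∪-closed X∈ Y∈) (⊆∧≢⇒⊂ (p⊆p∪q Y) X≢X∪Y)
    (⊆∧≢⇒⊂ (∪-lub (proj₁ X⊂T) (proj₁ Y⊂T)) X∪Y≢T))

  Balanced : Set
  Balanced = ∑ deficit (members 𝓐) ≤ ∑ surplus (members 𝓐)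

  -- Members that are not small have deficit 0 and no surplus is negative, so any list holding the
  -- small members may be weighed against any choice of distinct paying members.
  balanced : ∀ Ys Zs → (∀ {X} → X ∈ᶠ 𝓐 → Small X → X List.∈ Ys) → Unique Zs → (∀ {Z} → Z List.∈ Zs → Z ∈ᶠ 𝓐) →
    ∑ deficit Ys ≤ ∑ surplus Zs → Balanced
  balanced Ys Zs small uZs Zs⊆ d≤s = ≤-trans (∑-cover deficit (distinct 𝓐) small′)
    (≤-trans d≤s (∑-cover surplus uZs (inj₂ ∘ Zs⊆)))
    where
    small′ : ∀ {X} → X ∈ᶠ 𝓐 → deficit X ≡ 0 ⊎ X List.∈ Ys
    small′ {X} X∈ with 2 * ∣ X ∣ <? n
    ... | yes sm = inj₂ (small X∈ sm)
    ... | no ¬sm = inj₁ (m≤n⇒m∸n≡0 (≮⇒≥ ¬sm))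

  surplus-⊤ : surplus (⊤ {n}) ≡ n
  surplus-⊤ = begin
    2 * ∣ ⊤ {n} ∣ ∸ n  ≡⟨ cong (λ m → 2 * m ∸ n) (∣⊤∣≡n n) ⟩
    n + (n + 0) ∸ n    ≡⟨ m+n∸m≡n n (n + 0) ⟩
    n + 0              ≡⟨ +-identityʳ n ⟩
    n                  ∎
    where open ≡-Reasoning

  balanced-by-⊤ : ∀ Ys → (∀ {X} → X ∈ᶠ 𝓐 → Small X → X List.∈ Ys) → ∑ deficit Ys ≤ n → Balanced
  balanced-by-⊤ Ys small d≤n = balanced Ys (⊤ ∷ []) small ([] ∷ []) (λ {(here refl) → ⊤∈𝓐})
    (subst (∑ deficit Ys ≤_) (sym (trans (+-identityʳ (surplus (⊤ {n}))) surplus-⊤)) d≤n)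

  -- A single deficit is at most `n`, so `⊤` pays. `S` may lie outside the family: for an empty
  -- cover it is `⊥`.
  unique-small⇒balanced : ∀ S → (∀ {X} → X ∈ᶠ 𝓐 → Small X → X ≡ S) → Balanced
  unique-small⇒balanced S small = balanced-by-⊤ (S ∷ []) (λ X∈ sm → here (small X∈ sm))
    (subst (_≤ n) (sym (+-identityʳ (deficit S))) (m∸n≤m n (2 * ∣ S ∣)))

  -- Minimum covers with a single set that is not a minimal member.

  module OneCover {S} (S∈ : S ∈ᶠ 𝓐) (S-small : Small S) (S-nonempty : Nonempty S)
    (small⊆S : ∀ {X} → X ∈ᶠ 𝓐 → Small X → X ⊆ S)
    {X₀} (X₀∈ : X₀ ∈ᶠ 𝓐) (X₀⊂S : X₀ ⊂ S) where

    avoiding : Fin n → List (Subset n)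
    avoiding x = filter (λ A → ¬? (x ∈? A)) (members 𝓐)

    -- For `x` outside `S` this is the largest member avoiding `x`.
    M : Fin n → Subset n
    M x = ⋃ (avoiding x)

    x∉M : ∀ x → x ∉ M x
    x∉M x x∈M with ∈⋃⁻ (avoiding x) x∈M
    ... | A , A∈ , x∈A = proj₂ (∈-filter⁻ (λ A → ¬? (x ∈? A)) {xs = members 𝓐} A∈) x∈A

    ⊆M : ∀ {x A} → A ∈ᶠ 𝓐 → x ∉ A → A ⊆ M x
    ⊆M {x} A∈ x∉A = ∈⇒⊆⋃ (∈-filter⁺ (λ A → ¬? (x ∈? A)) A∈ x∉A)

    M∈ : ∀ {x} → x ∉ S → M x ∈ᶠ 𝓐
    M∈ {x} x∉S = ⋃-closed (avoiding x) (∈-filter⁺ (λ A → ¬? (x ∈? A)) S∈ x∉S)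
      (proj₁ ∘ ∈-filter⁻ (λ A → ¬? (x ∈? A)) {xs = members 𝓐})

    -- Suppose `M x` is not `S` and misses some `y ≠ x`. A member separating the two cannot contain
    -- `y` and avoid `x`, so it contains `x` and avoids `y`. Hence `x ∈ M y`, and
    -- `X₀ ⊂ S ⊂ M x ⊂ M y ⊂ ⊤` is too long.
    M≡S⊎coatom : ∀ {x} → x ∉ S → M x ≡ S ⊎ M x ≡ ⊤ - x
    M≡S⊎coatom {x} x∉S with M x ≟ˢ S
    ... | yes Mx≡S = inj₁ Mx≡S
    ... | no  Mx≢S = inj₂ (⊆-antisym (λ y∈M → x∈p∧x≢y⇒x∈p-y ∈⊤ λ {refl → x∉M x y∈M}) ⊤-x⊆M)
      where
      y∈M : ∀ y → y ≢ x → y ∈ M x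
      y∈M y y≢x with y ∈? M x
      ... | yes y∈ = y∈
      ... | no  y∉ with sep x y (≢-sym y≢x)
      ... | A , A∈ , inj₂ (x∉A , y∈A) = ⊆M A∈ x∉A y∈A
      ... | A , A∈ , inj₁ (x∈A , y∉A) = Empty-elim (noChain₅ X₀∈ S∈ (M∈ x∉S) (M∈ y∉S) ⊤∈𝓐 X₀⊂S
        (⊆∧≢⇒⊂ (⊆M S∈ x∉S) (≢-sym Mx≢S))
        (⊆M (M∈ x∉S) y∉ , x , ⊆M A∈ y∉A x∈A , x∉M x)
        (⊆⊤ , y , ∈⊤ , x∉M y))
        where
        y∉S : y ∉ S
        y∉S = y∉ ∘ ⊆M S∈ x∉S
      ⊤-x⊆M : ⊤ - x ⊆ M x
      ⊤-x⊆M {y} y∈ = y∈M y λ {refl → x∈p─q⇒x∉q ⊤ ⁅ x ⁆ y∈ (x∈⁅x⁆ x)}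

    -- A member separating `x` from `y` lies in `M` of the point it avoids, hence in `S`, yet it
    -- contains the other point.
    M≡S-unique : ∀ {x y} → x ∉ S → y ∉ S → M x ≡ S → M y ≡ S → x ≡ y
    M≡S-unique {x} {y} x∉S y∉S Mx≡S My≡S with x Fin.≟ y
    ... | yes x≡y = x≡y
    ... | no  x≢y with sep x y x≢y
    ... | A , A∈ , inj₁ (x∈A , y∉A) = contradiction (subst (x ∈_) My≡S (⊆M A∈ y∉A x∈A)) x∉S
    ... | A , A∈ , inj₂ (x∉A , y∈A) = contradiction (subst (y ∈_) Mx≡S (⊆M A∈ x∉A y∈A)) y∉S

    -- Every point outside `S` gives a coatom, except at most one point `x₀`. At least `∣ S ∣ + 1`
    -- points lie outside `S`, so enough remain after dropping `x₀`.
    coatoms : ∃[ E ] (∣ S ∣ ≤ ∣ E ∣ × (∀ {x} → x ∈ E → x ∉ S × (⊤ - x) ∈ᶠ 𝓐))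
    coatoms with Fin.any? (λ x → ¬? (x ∈? S) ×-dec (M x ≟ˢ S))
    ... | no none = ∁ S , s≤ , coatom
      where
      s≤ : ∣ S ∣ ≤ ∣ ∁ S ∣
      s≤ = subst (∣ S ∣ ≤_) (sym (∣∁p∣≡n∸∣p∣ S))
        (m+n≤o⇒m≤o∸n ∣ S ∣ (≤-trans (≤-reflexive (cong (_+_ ∣ S ∣) (sym (+-identityʳ ∣ S ∣)))) (<⇒≤ S-small)))
      coatom : ∀ {x} → x ∈ ∁ S → x ∉ S × (⊤ - x) ∈ᶠ 𝓐
      coatom {x} x∈ with M≡S⊎coatom (x∈∁p⇒x∉p x∈)
      ... | inj₁ Mx≡S = contradiction (x , x∈∁p⇒x∉p x∈ , Mx≡S) none
      ... | inj₂ Mx≡  = x∈∁p⇒x∉p x∈ , subst (_∈ᶠ 𝓐) Mx≡ (M∈ (x∈∁p⇒x∉p x∈))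
    ... | yes (x₀ , x₀∉S , Mx₀≡S) = ∁ (S ∪ ⁅ x₀ ⁆) , s≤ , coatom
      where
      ∣S∪x₀∣≤ : ∣ S ∪ ⁅ x₀ ⁆ ∣ ≤ ∣ S ∣ + 1
      ∣S∪x₀∣≤ = ≤-trans (m≤m+n _ ∣ S ∩ ⁅ x₀ ⁆ ∣)
        (≤-reflexive (trans (∣p∪q∣+∣p∩q∣≡∣p∣+∣q∣ S ⁅ x₀ ⁆) (cong (_+_ ∣ S ∣) (∣⁅x⁆∣≡1 x₀))))
      double : ∀ s → s + (s + 1) ≡ suc (2 * s)
      double = solve-∀
      s≤ : ∣ S ∣ ≤ ∣ ∁ (S ∪ ⁅ x₀ ⁆) ∣
      s≤ = subst (∣ S ∣ ≤_) (sym (∣∁p∣≡n∸∣p∣ (S ∪ ⁅ x₀ ⁆)))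
        (m+n≤o⇒m≤o∸n ∣ S ∣ (≤-trans (+-monoʳ-≤ ∣ S ∣ ∣S∪x₀∣≤) (≤-trans (≤-reflexive (double ∣ S ∣)) S-small)))
      coatom : ∀ {x} → x ∈ ∁ (S ∪ ⁅ x₀ ⁆) → x ∉ S × (⊤ - x) ∈ᶠ 𝓐
      coatom {x} x∈ with x∈∁p⇒x∉p x∈
      ... | x∉ with M≡S⊎coatom (x∉ ∘ p⊆p∪q ⁅ x₀ ⁆)
      ... | inj₁ Mx≡S = contradiction
        (subst (_∈ ⁅ x₀ ⁆) (M≡S-unique x₀∉S (x∉ ∘ p⊆p∪q ⁅ x₀ ⁆) Mx₀≡S Mx≡S) (x∈⁅x⁆ x₀)) (x∉ ∘ q⊆p∪q S ⁅ x₀ ⁆)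
      ... | inj₂ Mx≡  = x∉ ∘ p⊆p∪q ⁅ x₀ ⁆ , subst (_∈ᶠ 𝓐) Mx≡ (M∈ (x∉ ∘ p⊆p∪q ⁅ x₀ ⁆))

    E : Subset n
    E = proj₁ coatoms

    Ps : List (Subset n)
    Ps = filter (_⊂? S) (members 𝓐)

    Ps⊆ : ∀ {X} → X List.∈ Ps → X ∈ᶠ 𝓐 × X ⊂ S
    Ps⊆ = ∈-filter⁻ (_⊂? S) {xs = members 𝓐}

    coatom≡n∸1 : ∀ (x : Fin n) → suc ∣ ⊤ - x ∣ ≡ n
    coatom≡n∸1 x = begin
      1 + ∣ ⊤ - x ∣          ≡⟨ +-comm 1 ∣ ⊤ - x ∣ ⟩
      ∣ ⊤ - x ∣ + 1          ≡⟨ cong (_+_ ∣ ⊤ - x ∣) (∣⁅x⁆∣≡1 x) ⟨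
      ∣ ⊤ - x ∣ + ∣ ⁅ x ⁆ ∣  ≡⟨ ⊆⇒∣q─p∣+∣p∣≡∣q∣ {p = ⁅ x ⁆} ⊆⊤ ⟩
      ∣ ⊤ {n} ∣              ≡⟨ ∣⊤∣≡n n ⟩
      n                      ∎
      where open ≡-Reasoning

    surplus-coatom : ∀ x → surplus (⊤ - x) ≡ n ∸ 2
    surplus-coatom x = begin
      2 * m ∸ n              ≡⟨ cong (2 * m ∸_) (coatom≡n∸1 x) ⟨
      m + (m + 0) ∸ suc m    ≡⟨ cong₂ _∸_ (cong (_+_ m) (+-identityʳ m)) (+-comm 1 m) ⟩
      m + m ∸ (m + 1)        ≡⟨ [m+n]∸[m+o]≡n∸o m m 1 ⟩
      suc m ∸ 2              ≡⟨ cong (_∸ 2) (coatom≡n∸1 x) ⟩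
      n ∸ 2                  ∎
      where
      open ≡-Reasoning
      m = ∣ ⊤ - x ∣

    Zs : List (Subset n)
    Zs = map (⊤ -_) (elements E)

    coatom-injective : ∀ {x y : Fin n} → ⊤ - x ≡ ⊤ - y → x ≡ y
    coatom-injective {x} {y} eq with x Fin.≟ y
    ... | yes x≡y = x≡y
    ... | no  x≢y = contradiction (x∈⁅x⁆ x)
      (x∈p─q⇒x∉q ⊤ ⁅ x ⁆ (subst (x ∈_) (sym eq) (x∈p∧x≢y⇒x∈p-y ∈⊤ x≢y)))

    Zs⊆ : ∀ {Z} → Z List.∈ Zs → Z ∈ᶠ 𝓐 × ∃[ x ] Z ≡ ⊤ - x
    Zs⊆ Z∈ with ∈-map⁻ (⊤ -_) Z∈
    ... | x , x∈ , refl = proj₂ (proj₂ (proj₂ coatoms) (∈-elements⁻ x∈)) , x , refl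

    ⊤∷Zs-unique : Unique (⊤ ∷ Zs)
    ⊤∷Zs-unique = All.tabulate ⊤∉ ∷ Unique.map⁺ coatom-injective (elements-unique E)
      where
      ⊤∉ : ∀ {Z} → Z List.∈ Zs → ⊤ ≢ Z
      ⊤∉ Z∈ ⊤≡Z with proj₂ (Zs⊆ Z∈)
      ... | x , refl = x∈p─q⇒x∉q ⊤ ⁅ x ⁆ (subst (x ∈_) ⊤≡Z ∈⊤) (x∈⁅x⁆ x)

    ∑surplus≡ : ∑ surplus (⊤ ∷ Zs) ≡ n + ∣ E ∣ * (n ∸ 2)
    ∑surplus≡ = cong₂ _+_ surplus-⊤ (begin
      ∑ surplus Zs             ≡⟨ ∑-const surplus (n ∸ 2) Zs (λ Z∈ → eq (proj₂ (Zs⊆ Z∈))) ⟩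
      length Zs * (n ∸ 2)      ≡⟨ cong (_* (n ∸ 2)) (trans (length-map (⊤ -_) (elements E)) (length-elements E)) ⟩
      ∣ E ∣ * (n ∸ 2)          ∎)
      where
      open ≡-Reasoning
      eq : ∀ {Z} → ∃[ x ] Z ≡ ⊤ - x → surplus Z ≡ n ∸ 2
      eq (x , refl) = surplus-coatom x

    d : ℕ
    d = n ∸ 2 * ∣ S ∣

    2s+d≡n : 2 * ∣ S ∣ + d ≡ n
    2s+d≡n = m+[n∸m]≡n (<⇒≤ S-small)

    -- A coatom from `E` contains `S`. Equality would give `∣ S ∣ = n - 1`, impossible for a small
    -- nonempty set. With `V` at hand, a member strictly between some `X` in `Ps` and `S` completes
    -- a chain of five.
    above : ∃[ V ] (V ∈ᶠ 𝓐 × S ⊂ V × V ⊂ ⊤)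
    above with nonempty? E
    ... | no  empty = contradiction
      (subst (1 ≤_) (trans (cong ∣_∣ (Empty-unique empty)) (∣⊥∣≡0 n)) (≤-trans (Nonempty⇒∣p∣>0 S-nonempty) (proj₁ (proj₂ coatoms))))
      λ ()
    ... | yes (x , x∈E) with proj₂ (proj₂ coatoms) x∈E
    ... | x∉S , coatom∈ = ⊤ - x , coatom∈ , ⊆∧≢⇒⊂ S⊆ S≢ , x∈p⇒p-x⊂p ∈⊤
      where
      S⊆ : S ⊆ ⊤ - x
      S⊆ y∈S = x∈p∧x≢y⇒x∈p-y ∈⊤ λ {refl → x∉S y∈S}
      S≢ : S ≢ ⊤ - x
      S≢ refl = contradiction (Nonempty⇒∣p∣>0 S-nonempty) (<⇒≱ s<1)
        where
        s<1 : ∣ S ∣ < 1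
        s<1 = +-cancelˡ-< ∣ S ∣ ∣ S ∣ 1 (subst₂ _<_ (cong (_+_ ∣ S ∣) (+-identityʳ ∣ S ∣)) (trans (sym (coatom≡n∸1 x)) (+-comm 1 ∣ S ∣)) S-small)

    Ps-cover : ∀ {X Y} → X List.∈ Ps → Y List.∈ Ps → X ≢ Y → S ⊆ X ∪ Y
    Ps-cover {X} {Y} X∈ Y∈ X≢Y =
      subst (_⊆ (X ∪ Y)) (join (proj₁ (Ps⊆ X∈)) (proj₁ (Ps⊆ Y∈)) (proj₂ (Ps⊆ X∈)) (proj₂ (Ps⊆ Y∈)) X≢Y short) ⊆-refl
      where
      short : ∀ {W Z} → W ≡ X ⊎ W ≡ Y → Z ∈ᶠ 𝓐 → W ⊂ Z → Z ⊂ S → Empty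
      short W≡ Z∈ W⊂Z Z⊂S with above
      ... | V , V∈ , S⊂V , V⊂⊤ = noChain₅ ([ (λ {refl → proj₁ (Ps⊆ X∈)}) , (λ {refl → proj₁ (Ps⊆ Y∈)}) ]′ W≡)
        Z∈ S∈ V∈ ⊤∈𝓐 W⊂Z Z⊂S S⊂V V⊂⊤

    ∑deficit≤ : ∑ deficit (S ∷ Ps) ≤ d + (d + 2) * ∣ S ∣
    ∑deficit≤ = +-monoʳ-≤ d (begin
      ∑ deficit Ps                             ≤⟨ ∑-mono Ps bound ⟩
      ∑ (λ X → (d + 2) * ∣ S ─ X ∣) Ps         ≡⟨ ∑-*ˡ (d + 2) (λ X → ∣ S ─ X ∣) Ps ⟩
      (d + 2) * ∑ (λ X → ∣ S ─ X ∣) Ps         ≤⟨ *-monoʳ-≤ (d + 2) (packing S id (Unique.filter⁺ (_⊂? S) (distinct 𝓐)) Ps-cover) ⟩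
      (d + 2) * ∣ S ∣                          ∎)
      where
      open ≤-Reasoning
      bound : ∀ {X} → X List.∈ Ps → deficit X ≤ (d + 2) * ∣ S ─ X ∣
      bound {X} X∈ with proj₂ (Ps⊆ X∈)
      ... | X⊆S , x , x∈S , x∉X = positive-gap ∣ S ─ X ∣ ∣ X ∣ (⊆⇒∣q─p∣+∣p∣≡∣q∣ X⊆S)
        (Nonempty⇒∣p∣>0 (x , x∈p∧x∉q⇒x∈p─q x∈S x∉X)) 2s+d≡n

    oneCover-balanced : Balanced
    oneCover-balanced = balanced (S ∷ Ps) (⊤ ∷ Zs) small ⊤∷Zs-unique
      (λ {(here refl) → ⊤∈𝓐 ; (there Z∈) → proj₁ (Zs⊆ Z∈)})
      (≤-trans ∑deficit≤ (subst (d + (d + 2) * ∣ S ∣ ≤_) (sym ∑surplus≡)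
        (coatoms-suffice 2s+d≡n (Nonempty⇒∣p∣>0 S-nonempty) (proj₁ (proj₂ coatoms)))))
      where
      small : ∀ {X} → X ∈ᶠ 𝓐 → Small X → X List.∈ (S ∷ Ps)
      small {X} X∈ sm with X ≟ˢ S
      ... | yes X≡S = here X≡S
      ... | no  X≢S = there (∈-filter⁺ (_⊂? S) X∈ (⊆∧≢⇒⊂ (small⊆S X∈ sm) X≢S))

  -- Two disjoint sets of half size and the other small members.

  record Other (S T N : Subset n) : Set where
    field
      member : N ∈ᶠ 𝓐
      small  : Small N
      -- Inclusion in `S ∪ T` is kept as a pointwise alternative, so that exchanging `S` and `T`
      -- only swaps the summands.
      within : ∀ {x} → x ∈ N → x ∈ S ⊎ x ∈ T
      ≢S     : N ≢ S
      ≢T     : N ≢ T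

  module Halves {S T : Subset n} {s : ℕ} {z : Fin n} (S∈ : S ∈ᶠ 𝓐) (T∈ : T ∈ᶠ 𝓐)
    (disjoint : ∀ {x} → x ∈ S → x ∉ T) (∣S∣≡s : ∣ S ∣ ≡ s) (∣T∣≡s : ∣ T ∣ ≡ s) (T-nonempty : Nonempty T)
    (1+2s≡n : suc (2 * s) ≡ n) (z∉S : z ∉ S) (z∉T : z ∉ T)
    {Ns : List (Subset n)} (Ns-unique : Unique Ns) (other : ∀ {N} → N List.∈ Ns → Other S T N) where

    open Other

    2s+1≡n : 2 * s + 1 ≡ n
    2s+1≡n = trans (+-comm (2 * s) 1) 1+2s≡n

    S∪T∈ : (S ∪ T) ∈ᶠ 𝓐
    S∪T∈ = ∪-closed S∈ T∈

    S∪T⊂⊤ : S ∪ T ⊂ ⊤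
    S∪T⊂⊤ = ⊆⊤ , z , ∈⊤ , [ z∉S , z∉T ]′ ∘ x∈p∪q⁻ S T

    S⊂S∪T : S ⊂ S ∪ T
    S⊂S∪T = p⊆p∪q T , proj₁ T-nonempty , q⊆p∪q S T (proj₂ T-nonempty) , λ x∈S → disjoint x∈S (proj₂ T-nonempty)

    ∣N∣≤s : ∀ {N} → N List.∈ Ns → ∣ N ∣ ≤ s
    ∣N∣≤s {N} N∈ = *-cancelˡ-≤ 2 (m<1+n⇒m≤n (subst (2 * ∣ N ∣ <_) (sym 1+2s≡n) (small (other N∈))))

    S∪N⊆S∪T : ∀ {N} → N List.∈ Ns → S ∪ N ⊆ S ∪ T
    S∪N⊆S∪T N∈ = ∪-lub (p⊆p∪q T) (x∈p∪q⁺ ∘ within (other N∈))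

    T⊈N : ∀ {N} → N List.∈ Ns → T ⊈ N
    T⊈N {N} N∈ T⊆N = ≢T (other N∈) (sym (⊆∧∣≥∣⇒≡ T⊆N (subst (∣ N ∣ ≤_) (sym ∣T∣≡s) (∣N∣≤s N∈))))

    module Inside {N₀} (N₀∈ : N₀ List.∈ Ns) (N₀⊆S : N₀ ⊆ S) where

      N₀⊂S : N₀ ⊂ S
      N₀⊂S = ⊆∧≢⇒⊂ N₀⊆S (≢S (other N₀∈))

      -- If `S ∪ N` were strictly between, `N₀ ⊂ S ⊂ S ∪ N ⊂ S ∪ T ⊂ ⊤` would be too long. If it
      -- were `S ∪ T`, disjointness would put `T` inside `N`. So it is `S`.
      N⊂S : ∀ {N} → N List.∈ Ns → N ⊂ S
      N⊂S {N} N∈ with S ≟ˢ (S ∪ N) | (S ∪ N) ≟ˢ (S ∪ T)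
      ... | yes S≡ | _ = ⊆∧≢⇒⊂ (subst (N ⊆_) (sym S≡) (q⊆p∪q S N)) (≢S (other N∈))
      ... | no  S≢ | no  B≢ = Empty-elim (noChain₅ (member (other N₀∈)) S∈ (∪-closed S∈ (member (other N∈))) S∪T∈ ⊤∈𝓐
        N₀⊂S (⊆∧≢⇒⊂ (p⊆p∪q N) S≢) (⊆∧≢⇒⊂ (S∪N⊆S∪T N∈) B≢) S∪T⊂⊤)
      ... | no  _  | yes B≡ = Empty-elim (T⊈N N∈ T⊆N)
        where
        T⊆N : T ⊆ N
        T⊆N {x} x∈T with x∈p∪q⁻ S N (subst (x ∈_) (sym B≡) (q⊆p∪q S T x∈T))
        ... | inj₁ x∈S = contradiction x∈T (disjoint x∈S)
        ... | inj₂ x∈N = x∈N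

      cover : ∀ {X Y} → X List.∈ Ns → Y List.∈ Ns → X ≢ Y → S ⊆ X ∪ Y
      cover {X} {Y} X∈ Y∈ X≢Y = ⊆-reflexive (sym
        (join (member (other X∈)) (member (other Y∈)) (N⊂S X∈) (N⊂S Y∈) X≢Y λ W≡ Z∈ W⊂Z Z⊂S →
          noChain₅ ([ (λ {refl → member (other X∈)}) , (λ {refl → member (other Y∈)}) ]′ W≡)
            Z∈ S∈ S∪T∈ ⊤∈𝓐 W⊂Z Z⊂S S⊂S∪T S∪T⊂⊤))

      -- The factor 3 is `d + 2` for `d = n - 2 * s = 1`.
      bound : ∀ {N} → N List.∈ Ns → deficit N ≤ 3 * ∣ S ─ N ∣
      bound {N} N∈ with N⊂S N∈
      ... | N⊆S , x , x∈S , x∉N = positive-gap ∣ S ─ N ∣ ∣ N ∣ (trans (⊆⇒∣q─p∣+∣p∣≡∣q∣ N⊆S) ∣S∣≡s)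
        (Nonempty⇒∣p∣>0 (x , x∈p∧x∉q⇒x∈p─q x∈S x∉N)) 2s+1≡n

      inside-bound : ∑ deficit Ns ≤ 3 * s
      inside-bound = begin
        ∑ deficit Ns                     ≤⟨ ∑-mono Ns bound ⟩
        ∑ (λ N → 3 * ∣ S ─ N ∣) Ns       ≡⟨ ∑-*ˡ 3 (λ N → ∣ S ─ N ∣) Ns ⟩
        3 * ∑ (λ N → ∣ S ─ N ∣) Ns       ≤⟨ *-monoʳ-≤ 3 (packing S id Ns-unique cover) ⟩
        3 * ∣ S ∣                        ≡⟨ cong (_*_ 3) ∣S∣≡s ⟩
        3 * s                            ∎
        where open ≤-Reasoning

    module Crossing (⊈S : ∀ {N} → N List.∈ Ns → N ⊈ S) (⊈T : ∀ {N} → N List.∈ Ns → N ⊈ T) where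

      -- Otherwise take `x` in `N` outside `S`, `t` in the trace of `N′` outside `N`, and `y` in `T`
      -- outside both. They make the first three inclusions proper in the chain `S`, `S ∪ N`,
      -- `S ∪ N ∪ N′`, `S ∪ T`, `⊤`.
      trace-⊈ : ∀ {N N′} → N List.∈ Ns → N′ List.∈ Ns → T ⊈ N ∪ N′ → N′ ∩ T ⊆ N
      trace-⊈ {N} {N′} N∈ N′∈ T⊈ with (N′ ∩ T) ⊆? N
      ... | yes ⊆N = ⊆N
      ... | no  ⊈N with ⊈⇒∃∉ ⊈N | ⊈⇒∃∉ T⊈ | ⊈⇒∃∉ (⊈S N∈)
      ... | t , t∈ , t∉N | y , y∈T , y∉ | x , x∈N , x∉S = Empty-elim
        (noChain₅ S∈ (∪-closed S∈ (member (other N∈))) (∪-closed (∪-closed S∈ (member (other N∈))) (member (other N′∈))) S∪T∈ ⊤∈𝓐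
          (p⊆p∪q N , x , q⊆p∪q S N x∈N , x∉S)
          (p⊆p∪q N′ , t , q⊆p∪q (S ∪ N) N′ (p∩q⊆p N′ T t∈) , [ t∉S , t∉N ]′ ∘ x∈p∪q⁻ S N)
          (∪-lub (S∪N⊆S∪T N∈) (x∈p∪q⁺ ∘ within (other N′∈)) , y , q⊆p∪q S T y∈T , y∉S∪N∪N′)
          S∪T⊂⊤)
        where
        t∉S : t ∉ S
        t∉S t∈S = disjoint t∈S (p∩q⊆q N′ T t∈)
        y∉S∪N∪N′ : y ∉ (S ∪ N) ∪ N′
        y∉S∪N∪N′ y∈ with x∈p∪q⁻ (S ∪ N) N′ y∈
        ... | inj₂ y∈N′ = y∉ (q⊆p∪q N N′ y∈N′)
        ... | inj₁ y∈S∪N with x∈p∪q⁻ S N y∈S∪N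
        ... | inj₁ y∈S = disjoint y∈S y∈T
        ... | inj₂ y∈N = y∉ (p⊆p∪q N′ y∈N)

      trace : ∀ {N N′} → N List.∈ Ns → N′ List.∈ Ns → N ∩ T ≢ N′ ∩ T → T ⊆ N ∪ N′
      trace {N} {N′} N∈ N′∈ ≢ with T ⊆? (N ∪ N′)
      ... | yes T⊆ = T⊆
      ... | no  T⊈ = contradiction (⊆-antisym
        (λ x∈ → x∈p∩q⁺ (trace-⊈ N′∈ N∈ (subst (T ⊈_) (∪-comm N N′) T⊈) x∈ , p∩q⊆q N T x∈))
        (λ x∈ → x∈p∩q⁺ (trace-⊈ N∈ N′∈ T⊈ x∈ , p∩q⊆q N′ T x∈))) ≢

      -- With `u` and `v` the sizes of the traces on `S` and `T`, and `c = s - v`, the deficit is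
      -- `2 * c + 1 - 2 * u`; here `u ≥ 1` because `N` is not inside `T`. The unit gained per set
      -- later makes the row bounds strict.
      row-gap : ∀ {N} → N List.∈ Ns → suc (deficit N) ≤ 2 * ∣ T ─ N ∩ T ∣
      row-gap {N} N∈ = gap (∣ N ∩ S ∣) (∣ N ∩ T ∣) (∣ T ─ N ∩ T ∣)
        (trans (⊆⇒∣q─p∣+∣p∣≡∣q∣ (p∩q⊆q N T)) ∣T∣≡s) 1≤u size≡ (<⇒≤ (small (other N∈)))
        where
        1≤u : 1 ≤ ∣ N ∩ S ∣
        1≤u with ⊈⇒∃∉ (⊈T N∈)
        ... | x , x∈N , x∉T = Nonempty⇒∣p∣>0 (x , x∈p∩q⁺ (x∈N , [ id , (λ x∈T → contradiction x∈T x∉T) ]′ (within (other N∈) x∈N)))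
        N─S≡N∩T : N ─ S ≡ N ∩ T
        N─S≡N∩T = ⊆-antisym
          (λ x∈ → x∈p∩q⁺ (p─q⊆p N S x∈ , [ (λ x∈S → contradiction x∈S (x∈p─q⇒x∉q N S x∈)) , id ]′ (within (other N∈) (p─q⊆p N S x∈))))
          (λ x∈ → x∈p∧x∉q⇒x∈p─q (p∩q⊆p N T x∈) λ x∈S → disjoint x∈S (p∩q⊆q N T x∈))
        size≡ : ∣ N ∩ S ∣ + ∣ N ∩ T ∣ ≡ ∣ N ∣
        size≡ = trans (cong (λ X → ∣ N ∩ S ∣ + ∣ X ∣) (sym N─S≡N∩T)) (∣p∩q∣+∣p─q∣≡∣p∣ N S)
        gap : ∀ u v c {x} → c + v ≡ s → 1 ≤ u → u + v ≡ x → 2 * x ≤ n → suc (n ∸ 2 * x) ≤ 2 * c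
        gap (suc u) v c {x} c+v≡s _ refl 2x≤n = +-cancelʳ-≤ (2 * x) _ _ (begin
          suc (n ∸ 2 * x) + 2 * x      ≡⟨ cong suc (m∸n+n≡m 2x≤n) ⟩
          suc n                        ≡⟨ cong suc 1+2s≡n ⟨
          suc (suc (2 * s))            ≡⟨ cong (λ m → suc (suc (2 * m))) c+v≡s ⟨
          suc (suc (2 * (c + v)))      ≤⟨ ≤-by (2 * u) (identity u v c) ⟩
          2 * c + 2 * x                ∎)
          where
          open ≤-Reasoning
          identity : ∀ u v c → suc (suc (2 * (c + v))) + 2 * u ≡ 2 * c + 2 * (suc u + v)
          identity = solve-∀

      -- A set inside `S ∪ T` is determined by its two traces, so with the trace on `S` fixed,
      -- distinct sets have distinct traces on `T`. By `trace` these pairwise cover `T`, and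
      -- `packing` applies to them.
      row-bound : ∀ {Xs} → Unique Xs → (∀ {X} → X List.∈ Xs → X List.∈ Ns) →
        (∀ {X Y} → X List.∈ Xs → Y List.∈ Xs → X ∩ S ≡ Y ∩ S) → ∑ deficit Xs + length Xs ≤ 2 * s
      row-bound {Xs} Xs-unique Xs⊆ same = begin
        ∑ deficit Xs + length Xs             ≡⟨ ∑-suc deficit Xs ⟨
        ∑ (λ N → suc (deficit N)) Xs                 ≤⟨ ∑-mono Xs (row-gap ∘ Xs⊆) ⟩
        ∑ (λ N → 2 * ∣ T ─ N ∩ T ∣) Xs       ≡⟨ ∑-*ˡ 2 (λ N → ∣ T ─ N ∩ T ∣) Xs ⟩
        2 * ∑ (λ N → ∣ T ─ N ∩ T ∣) Xs       ≤⟨ *-monoʳ-≤ 2 (packing T (_∩ T) Xs-unique cover) ⟩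
        2 * ∣ T ∣                            ≡⟨ cong (_*_ 2) ∣T∣≡s ⟩
        2 * s                                ∎
        where
        open ≤-Reasoning
        sub : ∀ {X Y} → X List.∈ Xs → Y List.∈ Xs → X ∩ T ≡ Y ∩ T → X ⊆ Y
        sub {X} {Y} X∈ Y∈ eq {x} x∈X with within (other (Xs⊆ X∈)) x∈X
        ... | inj₁ x∈S = p∩q⊆p Y S (subst (x ∈_) (same X∈ Y∈) (x∈p∩q⁺ (x∈X , x∈S)))
        ... | inj₂ x∈T = p∩q⊆p Y T (subst (x ∈_) eq (x∈p∩q⁺ (x∈X , x∈T)))
        cover : ∀ {X Y} → X List.∈ Xs → Y List.∈ Xs → X ≢ Y → T ⊆ X ∩ T ∪ Y ∩ T
        cover {X} {Y} X∈ Y∈ X≢Y x∈T = x∈p∪q⁺ (Sum.map (λ x∈X → x∈p∩q⁺ (x∈X , x∈T)) (λ x∈Y → x∈p∩q⁺ (x∈Y , x∈T))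
          (x∈p∪q⁻ X Y (trace (Xs⊆ X∈) (Xs⊆ Y∈) (λ eq → X≢Y (⊆-antisym (sub X∈ Y∈ eq) (sub Y∈ X∈ (sym eq)))) x∈T)))

  -- Minimum covers with two sets.

  module TwoCover {S T : Subset n} (4≤n : 4 ≤ n) (S∈ : S ∈ᶠ 𝓐) (T∈ : T ∈ᶠ 𝓐) (S-small : Small S) (T-small : Small T)
    (S⊈T : S ⊈ T) (T⊈S : T ⊈ S) (S∪T-large : ¬ Small (S ∪ T))
    (small⊆S∪T : ∀ {X} → X ∈ᶠ 𝓐 → Small X → X ⊆ S ∪ T) where

    B : Subset n
    B = S ∪ T

    B∈ : B ∈ᶠ 𝓐
    B∈ = ∪-closed S∈ T∈

    ∣B∣<n : ∣ B ∣ < n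
    ∣B∣<n = *-cancelˡ-< 2 ∣ B ∣ n (begin-strict
      2 * ∣ B ∣                       ≤⟨ *-monoʳ-≤ 2 (≤-by ∣ S ∩ T ∣ (∣p∪q∣+∣p∩q∣≡∣p∣+∣q∣ S T)) ⟩
      2 * (∣ S ∣ + ∣ T ∣)             ≡⟨ *-distribˡ-+ 2 ∣ S ∣ ∣ T ∣ ⟩
      2 * ∣ S ∣ + 2 * ∣ T ∣           <⟨ +-mono-< S-small T-small ⟩
      n + n                           ≡⟨ cong (_+_ n) (+-identityʳ n) ⟨
      2 * n                           ∎)
      where open ≤-Reasoning

    B⊂⊤ : B ⊂ ⊤
    B⊂⊤ = ⊆∧≢⇒⊂ ⊆⊤ λ B≡⊤ → <⇒≢ ∣B∣<n (trans (cong ∣_∣ B≡⊤) (∣⊤∣≡n n))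

    n≤2∣B∣ : n ≤ 2 * ∣ B ∣
    n≤2∣B∣ = ≮⇒≥ S∪T-large

    small⇒⊂B : ∀ {X} → X ∈ᶠ 𝓐 → Small X → X ⊂ B
    small⇒⊂B X∈ sm = ⊆∧≢⇒⊂ (small⊆S∪T X∈ sm) λ {refl → S∪T-large sm}

    module Above {V} (V∈ : V ∈ᶠ 𝓐) (B⊂V : B ⊂ V) (V⊂⊤ : V ⊂ ⊤) where

      Ps : List (Subset n)
      Ps = filter (_⊂? B) (members 𝓐)

      Ps⊆ : ∀ {X} → X List.∈ Ps → X ∈ᶠ 𝓐 × X ⊂ B
      Ps⊆ = ∈-filter⁻ (_⊂? B) {xs = members 𝓐}

      cover : ∀ {X Y} → X List.∈ Ps → Y List.∈ Ps → X ≢ Y → B ⊆ X ∪ Y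
      cover {X} {Y} X∈ Y∈ X≢Y = ⊆-reflexive (sym
        (join (proj₁ (Ps⊆ X∈)) (proj₁ (Ps⊆ Y∈)) (proj₂ (Ps⊆ X∈)) (proj₂ (Ps⊆ Y∈)) X≢Y λ W≡ Z∈ W⊂Z Z⊂B →
          noChain₅ ([ (λ {refl → proj₁ (Ps⊆ X∈)}) , (λ {refl → proj₁ (Ps⊆ Y∈)}) ]′ W≡)
            Z∈ B∈ V∈ ⊤∈𝓐 W⊂Z Z⊂B B⊂V V⊂⊤))

      -- Each deficit is at most `n / ∣ B ∣` times the complement in `B`, and the complements pack
      -- into `B`. Cancelling `∣ B ∣` leaves at most `n`, the surplus of `⊤`.
      ∣B∣*∑deficit≤ : ∣ B ∣ * ∑ deficit Ps ≤ ∣ B ∣ * n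
      ∣B∣*∑deficit≤ = begin
        ∣ B ∣ * ∑ deficit Ps               ≡⟨ ∑-*ˡ ∣ B ∣ deficit Ps ⟨
        ∑ (λ X → ∣ B ∣ * deficit X) Ps     ≤⟨ ∑-mono Ps (λ {X} X∈ → proportional ∣ B ─ X ∣ ∣ X ∣
                                                (⊆⇒∣q─p∣+∣p∣≡∣q∣ (proj₁ (proj₂ (Ps⊆ X∈)))) n≤2∣B∣) ⟩
        ∑ (λ X → n * ∣ B ─ X ∣) Ps         ≡⟨ ∑-*ˡ n (λ X → ∣ B ─ X ∣) Ps ⟩
        n * ∑ (λ X → ∣ B ─ X ∣) Ps         ≤⟨ *-monoʳ-≤ n (packing B id (Unique.filter⁺ (_⊂? B) (distinct 𝓐)) cover) ⟩
        n * ∣ B ∣                          ≡⟨ *-comm n ∣ B ∣ ⟩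
        ∣ B ∣ * n                          ∎
        where open ≤-Reasoning

      above-balanced : Balanced
      above-balanced = balanced-by-⊤ Ps (λ X∈ sm → ∈-filter⁺ (_⊂? B) X∈ (small⇒⊂B X∈ sm))
        (*-cancelˡ-≤ ∣ B ∣ {{>-nonZero (Nonempty⇒∣p∣>0 (proj₁ S-elt , p⊆p∪q T (proj₁ (proj₂ S-elt))))}} ∣B∣*∑deficit≤)
        where
        S-elt : ∃[ x ] (x ∈ S × x ∉ T)
        S-elt = ⊈⇒∃∉ S⊈T

    module Tight (none : ∀ {V} → V ∈ᶠ 𝓐 → B ⊂ V → V ⊂ ⊤ → Empty) where

      z : Fin n
      z = proj₁ (proj₂ B⊂⊤)

      z∉B : z ∉ B
      z∉B = proj₂ (proj₂ (proj₂ B⊂⊤))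

      ∁B⊆z : ∁ B ⊆ ⁅ z ⁆
      ∁B⊆z {x} x∈ with x Fin.≟ z
      ... | yes refl = x∈⁅x⁆ z
      ... | no  x≢z with between B∈ x≢z (x∈∁p⇒x∉p x∈) z∉B
      ... | V , V∈ , B⊂V , V⊂⊤ = Empty-elim (none V∈ B⊂V V⊂⊤)

      n≡1+∣B∣ : n ≡ suc ∣ B ∣
      n≡1+∣B∣ = ≤-antisym (subst (n ≤_) (+-comm ∣ B ∣ 1) (≤-trans (m≤n+m∸n n ∣ B ∣) (+-monoʳ-≤ ∣ B ∣ n∸∣B∣≤1))) ∣B∣<n
        where
        n∸∣B∣≤1 : n ∸ ∣ B ∣ ≤ 1
        n∸∣B∣≤1 = subst₂ _≤_ (∣∁p∣≡n∸∣p∣ B) (∣⁅x⁆∣≡1 z) (p⊆q⇒∣p∣≤∣q∣ ∁B⊆z)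

      -- Read `β = ∣ B ∣` and `i = ∣ S ∩ T ∣`. Doubling the identity gives
      -- `2 * β + 2 * i = 2 * s + 2 * t ≤ 2 * β`, so `i = 0` and neither inequality can be strict.
      halves : ∀ {s t i β} → 2 * s ≤ β → 2 * t ≤ β → β + i ≡ s + t → i ≡ 0 × s ≡ t × β ≡ 2 * s
      halves {s} {t} {i} {β} 2s≤β 2t≤β β+i≡s+t = i≡0 , s≡t , trans β≡s+t (trans (cong (_+_ s) (sym s≡t)) (double s))
        where
        double : ∀ s → s + s ≡ 2 * s
        double = solve-∀
        2i≤0 : 2 * i ≤ 0
        2i≤0 = +-cancelˡ-≤ (β + β) _ _ (begin
          β + β + 2 * i      ≡⟨ regroup β i ⟩
          2 * (β + i)        ≡⟨ cong (_*_ 2) β+i≡s+t ⟩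
          2 * (s + t)        ≡⟨ *-distribˡ-+ 2 s t ⟩
          2 * s + 2 * t      ≤⟨ +-mono-≤ 2s≤β 2t≤β ⟩
          β + β              ≡⟨ +-identityʳ (β + β) ⟨
          β + β + 0          ∎)
          where
          open ≤-Reasoning
          regroup : ∀ β i → β + β + 2 * i ≡ 2 * (β + i)
          regroup = solve-∀
        i≡0 : i ≡ 0
        i≡0 = m+n≡0⇒m≡0 i (n≤0⇒n≡0 2i≤0)
        β≡s+t : β ≡ s + t
        β≡s+t = trans (sym (+-identityʳ β)) (trans (cong (_+_ β) (sym i≡0)) β+i≡s+t)
        s≡t : s ≡ t
        s≡t = ≤-antisym
          (+-cancelˡ-≤ s s t (subst₂ _≤_ (sym (double s)) β≡s+t 2s≤β))
          (+-cancelʳ-≤ t t s (subst₂ _≤_ (sym (double t)) β≡s+t 2t≤β))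

      sizes : ∣ S ∩ T ∣ ≡ 0 × ∣ S ∣ ≡ ∣ T ∣ × ∣ B ∣ ≡ 2 * ∣ S ∣
      sizes = halves (m<1+n⇒m≤n (subst (2 * ∣ S ∣ <_) n≡1+∣B∣ S-small)) (m<1+n⇒m≤n (subst (2 * ∣ T ∣ <_) n≡1+∣B∣ T-small))
        (∣p∪q∣+∣p∩q∣≡∣p∣+∣q∣ S T)

      s : ℕ
      s = ∣ S ∣

      ∣T∣≡s : ∣ T ∣ ≡ s
      ∣T∣≡s = sym (proj₁ (proj₂ sizes))

      1+2s≡n : suc (2 * s) ≡ n
      1+2s≡n = trans (cong suc (sym (proj₂ (proj₂ sizes)))) (sym n≡1+∣B∣)

      -- Here `4 ≤ n` enters, through `2 * s = n - 1 ≥ 3`. The consequence `3 * s + 2 ≤ 4 * s` would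
      -- fail at `s = 1`.
      2≤s : 2 ≤ s
      2≤s = *-cancelˡ-< 2 1 s (≤-pred (subst (4 ≤_) (sym 1+2s≡n) 4≤n))

      disjoint : ∀ {x} → x ∈ S → x ∉ T
      disjoint x∈S x∈T = contradiction (Nonempty⇒∣p∣>0 (_ , x∈p∩q⁺ (x∈S , x∈T))) (<⇒≱ (s≤s (≤-reflexive (proj₁ sizes))))

      isOther? : ∀ N → _
      isOther? N = (2 * ∣ N ∣ <? n) ×-dec ¬? (N ≟ˢ S) ×-dec ¬? (N ≟ˢ T)

      Ns : List (Subset n)
      Ns = filter isOther? (members 𝓐)

      Ns-unique : Unique Ns
      Ns-unique = Unique.filter⁺ isOther? (distinct 𝓐)

      other : ∀ {N} → N List.∈ Ns → Other S T N
      other N∈ with ∈-filter⁻ isOther? {xs = members 𝓐} N∈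
      ... | N∈𝓐 , sm , N≢S , N≢T = record
        { member = N∈𝓐 ; small = sm ; within = x∈p∪q⁻ S T ∘ small⊆S∪T N∈𝓐 sm ; ≢S = N≢S ; ≢T = N≢T }

      other′ : ∀ {N} → N List.∈ Ns → Other T S N
      other′ N∈ = record { member = member ; small = small ; within = Sum.swap ∘ within ; ≢S = ≢T ; ≢T = ≢S }
        where open Other (other N∈)

      module ST = Halves {z = z} S∈ T∈ disjoint refl ∣T∣≡s (proj₁ (⊈⇒∃∉ T⊈S) , proj₁ (proj₂ (⊈⇒∃∉ T⊈S))) 1+2s≡n
        (z∉B ∘ p⊆p∪q T) (z∉B ∘ q⊆p∪q S T) Ns-unique other
      module TS = Halves {z = z} T∈ S∈ (λ x∈T x∈S → disjoint x∈S x∈T) ∣T∣≡s refl (proj₁ (⊈⇒∃∉ S⊈T) , proj₁ (proj₂ (⊈⇒∃∉ S⊈T))) 1+2s≡n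
        (z∉B ∘ q⊆p∪q S T) (z∉B ∘ p⊆p∪q T) Ns-unique other′

      3s+2≤4s : 3 * s + 2 ≤ 4 * s
      3s+2≤4s = subst (3 * s + 2 ≤_) (+-comm (3 * s) s) (+-monoʳ-≤ (3 * s) 2≤s)

      module Crossing (⊈S : ∀ {N} → N List.∈ Ns → N ⊈ S) (⊈T : ∀ {N} → N List.∈ Ns → N ⊈ T) where

        module STC = ST.Crossing ⊈S ⊈T
        module TSC = TS.Crossing ⊈T ⊈S

        2s+2≤4s : 2 * s + 2 ≤ 4 * s
        2s+2≤4s = ≤-trans (+-monoˡ-≤ 2 (*-monoˡ-≤ s {2} {3} (s≤s (s≤s z≤n)))) 3s+2≤4s

        module TwoRows {N₀ N₁} (N₀∈ : N₀ List.∈ Ns) (N₁∈ : N₁ List.∈ Ns)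
          (≢∩S : N₀ ∩ S ≢ N₁ ∩ S) (≢∩T : N₀ ∩ T ≢ N₁ ∩ T) where

          B⊆N₀∪N₁ : B ⊆ N₀ ∪ N₁
          B⊆N₀∪N₁ = ∪-lub (TSC.trace N₀∈ N₁∈ ≢∩S) (STC.trace N₀∈ N₁∈ ≢∩T)

          -- The union contains `B`, of size `2 * s`, while each set has at most `s` elements.
          N₀∩N₁≡∅ : ∣ N₀ ∩ N₁ ∣ ≡ 0
          N₀∩N₁≡∅ = n≤0⇒n≡0 (+-cancelˡ-≤ (2 * s) _ _ (begin
            2 * s + ∣ N₀ ∩ N₁ ∣            ≡⟨ cong (λ m → m + ∣ N₀ ∩ N₁ ∣) (proj₂ (proj₂ sizes)) ⟨
            ∣ B ∣ + ∣ N₀ ∩ N₁ ∣            ≤⟨ +-monoˡ-≤ _ (p⊆q⇒∣p∣≤∣q∣ B⊆N₀∪N₁) ⟩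
            ∣ N₀ ∪ N₁ ∣ + ∣ N₀ ∩ N₁ ∣      ≡⟨ ∣p∪q∣+∣p∩q∣≡∣p∣+∣q∣ N₀ N₁ ⟩
            ∣ N₀ ∣ + ∣ N₁ ∣                ≤⟨ +-mono-≤ (ST.∣N∣≤s N₀∈) (ST.∣N∣≤s N₁∈) ⟩
            s + s                          ≡⟨ double s ⟩
            2 * s + 0                      ∎))
            where
            open ≤-Reasoning
            double : ∀ s → s + s ≡ 2 * s + 0
            double = solve-∀

          -- If the trace of `N` on `S` differs from both, `N ∪ N₀` and `N ∪ N₁` cover `S`; as `N₀`
          -- and `N₁` are disjoint, `N` contains `S`, which its size forbids.
          row : ∀ {N} → N List.∈ Ns → N ∩ S ≡ N₀ ∩ S ⊎ N ∩ S ≡ N₁ ∩ S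
          row {N} N∈ with (N ∩ S) ≟ˢ (N₀ ∩ S) | (N ∩ S) ≟ˢ (N₁ ∩ S)
          ... | yes eq | _      = inj₁ eq
          ... | no _   | yes eq = inj₂ eq
          ... | no ≢₀  | no ≢₁  = Empty-elim (TS.T⊈N N∈ S⊆N)
            where
            S⊆N : S ⊆ N
            S⊆N {x} x∈S with x∈p∪q⁻ N N₀ (TSC.trace N∈ N₀∈ ≢₀ x∈S) | x∈p∪q⁻ N N₁ (TSC.trace N∈ N₁∈ ≢₁ x∈S)
            ... | inj₁ x∈N | _ = x∈N
            ... | inj₂ _   | inj₁ x∈N = x∈N
            ... | inj₂ x∈₀ | inj₂ x∈₁ = contradiction (Nonempty⇒∣p∣>0 (x , x∈p∩q⁺ (x∈₀ , x∈₁)))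
              (<⇒≱ (s≤s (≤-reflexive N₀∩N₁≡∅)))

          Row : Subset n → List (Subset n)
          Row N = filter (λ X → (X ∩ S) ≟ˢ (N ∩ S)) Ns

          Row⊆ : ∀ {N X} → X List.∈ Row N → X List.∈ Ns × X ∩ S ≡ N ∩ S
          Row⊆ {N} = ∈-filter⁻ (λ X → (X ∩ S) ≟ˢ (N ∩ S)) {xs = Ns}

          -- `N` lies in its own row, so the length term of `row-bound` is at least 1.
          Row-bound : ∀ {N} → N List.∈ Ns → suc (∑ deficit (Row N)) ≤ 2 * s
          Row-bound {N} N∈ = begin
            1 + ∑ deficit (Row N)                     ≡⟨ +-comm 1 _ ⟩
            ∑ deficit (Row N) + 1                     ≤⟨ +-monoʳ-≤ _ (∈-length (∈-filter⁺ (λ X → (X ∩ S) ≟ˢ (N ∩ S)) N∈ refl)) ⟩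
            ∑ deficit (Row N) + length (Row N)        ≤⟨ STC.row-bound (Unique.filter⁺ (λ X → (X ∩ S) ≟ˢ (N ∩ S)) Ns-unique)
                                                          (proj₁ ∘ Row⊆ {N}) (λ X∈ Y∈ → trans (proj₂ (Row⊆ {N} X∈)) (sym (proj₂ (Row⊆ {N} Y∈)))) ⟩
            2 * s                                     ∎
            where open ≤-Reasoning

          two-rows-bound : ∑ deficit Ns + 2 ≤ 4 * s
          two-rows-bound = begin
            ∑ deficit Ns + 2                                          ≤⟨ +-monoˡ-≤ 2 (∑-cover deficit Ns-unique (inj₂ ∘ split)) ⟩
            ∑ deficit (Row N₀ ++ Row N₁) + 2                          ≡⟨ cong (λ m → m + 2) (∑-++ deficit (Row N₀) (Row N₁)) ⟩
            ∑ deficit (Row N₀) + ∑ deficit (Row N₁) + 2               ≡⟨ regroup (∑ deficit (Row N₀)) (∑ deficit (Row N₁)) ⟩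
            suc (∑ deficit (Row N₀)) + suc (∑ deficit (Row N₁))       ≤⟨ +-mono-≤ (Row-bound N₀∈) (Row-bound N₁∈) ⟩
            2 * s + 2 * s                                             ≡⟨ *-distribʳ-+ s 2 2 ⟨
            4 * s                                                     ∎
            where
            open ≤-Reasoning
            regroup : ∀ a b → a + b + 2 ≡ suc a + suc b
            regroup = solve-∀
            split : ∀ {N} → N List.∈ Ns → N List.∈ (Row N₀ ++ Row N₁)
            split N∈ with row N∈
            ... | inj₁ eq = ∈-++⁺ˡ (∈-filter⁺ (λ X → (X ∩ S) ≟ˢ (N₀ ∩ S)) N∈ eq)
            ... | inj₂ eq = ∈-++⁺ʳ (Row N₀) (∈-filter⁺ (λ X → (X ∩ S) ≟ˢ (N₁ ∩ S)) N∈ eq)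

        crossing? : ∀ N N′ → _
        crossing? N N′ = ¬? ((N ∩ S) ≟ˢ (N′ ∩ S)) ×-dec ¬? ((N ∩ T) ≟ˢ (N′ ∩ T))

        line-bound : ∑ deficit Ns + length Ns ≤ 2 * s → ∑ deficit Ns + 2 ≤ 4 * s
        line-bound le = ≤-trans (+-monoˡ-≤ 2 (≤-trans (m≤m+n _ (length Ns)) le)) 2s+2≤4s

        -- Unless two sets differ in both traces, all sets share one trace: either all agree with
        -- `N₀` on `S`, or some `N₁` does not, and then all agree with `N₀` on `T`.
        crossing-bound : ∀ {N₀} → N₀ List.∈ Ns → ∑ deficit Ns + 2 ≤ 4 * s
        crossing-bound {N₀} N₀∈ with Any.any? (λ N → Any.any? (crossing? N) Ns) Ns
        ... | yes found with List.find found
        ... | N , N∈ , found′ with List.find found′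
        ... | N′ , N′∈ , ≢∩S , ≢∩T = TwoRows.two-rows-bound N∈ N′∈ ≢∩S ≢∩T
        crossing-bound {N₀} N₀∈ | no none with Any.any? (λ N → ¬? ((N ∩ S) ≟ˢ (N₀ ∩ S))) Ns
        ... | no one-row = line-bound (STC.row-bound Ns-unique id λ X∈ Y∈ → trans (≡₀ X∈) (sym (≡₀ Y∈)))
          where
          ≡₀ : ∀ {X} → X List.∈ Ns → X ∩ S ≡ N₀ ∩ S
          ≡₀ {X} X∈ = decidable-stable ((X ∩ S) ≟ˢ (N₀ ∩ S)) λ ≢₀ → one-row (List.lose X∈ ≢₀)
        ... | yes found with List.find found
        ... | N₁ , N₁∈ , ≢₁ = line-bound (TSC.row-bound Ns-unique id λ X∈ Y∈ → trans (≡₀ X∈) (sym (≡₀ Y∈)))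
          where
          meet : ∀ {X Y} → X List.∈ Ns → Y List.∈ Ns → X ∩ S ≢ Y ∩ S → X ∩ T ≡ Y ∩ T
          meet {X} {Y} X∈ Y∈ ≢∩S = decidable-stable ((X ∩ T) ≟ˢ (Y ∩ T)) λ ≢∩T →
            none (List.lose X∈ (List.lose Y∈ (≢∩S , ≢∩T)))
          ≡₀ : ∀ {X} → X List.∈ Ns → X ∩ T ≡ N₀ ∩ T
          ≡₀ {X} X∈ with (X ∩ S) ≟ˢ (N₀ ∩ S)
          ... | no  ≢₀ = meet X∈ N₀∈ ≢₀
          -- `X` agrees with `N₀` on `S`, hence differs there from `N₁`, as `N₀` does; the traces on
          -- `T` are compared through `N₁`.
          ... | yes eq = trans (meet X∈ N₁∈ (λ eq′ → ≢₁ (trans (sym eq′) eq))) (meet N₁∈ N₀∈ ≢₁)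

      -- This is the budget left over: `⊤` and `B` bring surpluses `2 * s + 1` and `2 * s - 1`,
      -- while `S` and `T` use up 1 each.
      ∑Ns-bound : ∑ deficit Ns + 2 ≤ 4 * s
      ∑Ns-bound with Any.any? (_⊆? S) Ns | Any.any? (_⊆? T) Ns
      ... | yes found | _ with List.find found
      ... | N , N∈ , N⊆S = ≤-trans (+-monoˡ-≤ 2 (ST.Inside.inside-bound N∈ N⊆S)) 3s+2≤4s
      ∑Ns-bound | no _ | yes found with List.find found
      ... | N , N∈ , N⊆T = ≤-trans (+-monoˡ-≤ 2 (TS.Inside.inside-bound N∈ N⊆T)) 3s+2≤4s
      ∑Ns-bound | no ⊈S | no ⊈T = by-cases Ns refl
        where
        by-cases : ∀ Xs → Ns ≡ Xs → ∑ deficit Ns + 2 ≤ 4 * s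
        by-cases [] Ns≡[] = subst (λ Xs → ∑ deficit Xs + 2 ≤ 4 * s) (sym Ns≡[]) (≤-trans (m≤n+m 2 (3 * s)) 3s+2≤4s)
        by-cases (N ∷ _) Ns≡ = Crossing.crossing-bound
          (λ N∈ N⊆S → ⊈S (List.lose N∈ λ {x} → N⊆S {x})) (λ N∈ N⊆T → ⊈T (List.lose N∈ λ {x} → N⊆T {x})) (subst (N List.∈_) (sym Ns≡) (here refl))

      deficit-half : ∀ {X : Subset n} → ∣ X ∣ ≡ s → deficit X ≡ 1
      deficit-half {X} ∣X∣≡s = begin
        n ∸ 2 * ∣ X ∣            ≡⟨ cong₂ (λ i j → i ∸ 2 * j) (trans (sym 1+2s≡n) (+-comm 1 (2 * s))) ∣X∣≡s ⟩
        2 * s + 1 ∸ 2 * s        ≡⟨ m+n∸m≡n (2 * s) 1 ⟩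
        1                        ∎
        where open ≡-Reasoning

      surplus-B : suc (surplus B) ≡ 2 * s
      surplus-B = begin
        suc (2 * ∣ B ∣ ∸ n)                   ≡⟨ cong₂ (λ i j → suc (2 * i ∸ j)) (proj₂ (proj₂ sizes)) (sym 1+2s≡n) ⟩
        suc (2 * (2 * s) ∸ suc (2 * s))       ≡⟨ +-∸-assoc 1 {2 * (2 * s)} {suc (2 * s)} 1+2s≤4s ⟨
        2 * (2 * s) ∸ 2 * s                   ≡⟨ m+n∸m≡n (2 * s) (2 * s + 0) ⟩
        2 * s + 0                             ≡⟨ +-identityʳ (2 * s) ⟩
        2 * s                                 ∎
        where
        open ≡-Reasoning
        1+2s≤4s : suc (2 * s) ≤ 2 * (2 * s)
        1+2s≤4s = subst (_≤ 2 * (2 * s)) (sym 1+2s≡n) (subst (λ m → n ≤ 2 * m) (proj₂ (proj₂ sizes)) n≤2∣B∣)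

      tight-balanced : Balanced
      tight-balanced = balanced (S ∷ T ∷ Ns) (⊤ ∷ B ∷ []) small
        (((λ ⊤≡B → ⊂-irref (sym ⊤≡B) B⊂⊤) ∷ []) ∷ [] ∷ []) (λ {(here refl) → ⊤∈𝓐 ; (there (here refl)) → B∈})
        -- Both sides are raised by 1 because `surplus-B` gives the surplus `2 * s - 1` in successor
        -- form.
        (≤-pred (begin
          suc (deficit S + (deficit T + ∑ deficit Ns))
            ≡⟨ cong₂ (λ i j → suc (i + (j + ∑ deficit Ns))) (deficit-half {S} refl) (deficit-half {T} ∣T∣≡s) ⟩
          3 + ∑ deficit Ns                       ≡⟨ cong suc (+-comm 2 (∑ deficit Ns)) ⟩
          suc (∑ deficit Ns + 2)                 ≤⟨ s≤s ∑Ns-bound ⟩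
          suc (4 * s)                            ≡⟨ cong suc (*-distribʳ-+ s 2 2) ⟩
          suc (2 * s) + 2 * s                    ≡⟨ cong₂ _+_ (trans 1+2s≡n (sym surplus-⊤)) (sym surplus-B) ⟩
          surplus (⊤ {n}) + suc (surplus B)      ≡⟨ +-suc (surplus (⊤ {n})) (surplus B) ⟩
          suc (surplus (⊤ {n}) + surplus B)      ≡⟨ cong (λ m → suc (surplus (⊤ {n}) + m)) (+-identityʳ (surplus B)) ⟨
          suc (surplus (⊤ {n}) + (surplus B + 0)) ∎))
        where
        open ≤-Reasoning
        small : ∀ {X} → X ∈ᶠ 𝓐 → Small X → X List.∈ (S ∷ T ∷ Ns)
        small {X} X∈ sm with X ≟ˢ S | X ≟ˢ T
        ... | yes X≡S | _       = here X≡S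
        ... | no _    | yes X≡T = there (here X≡T)
        ... | no X≢S  | no X≢T  = there (there (∈-filter⁺ isOther? X∈ (sm , X≢S , X≢T)))

    twoCover-balanced : Balanced
    twoCover-balanced with Any.any? (λ V → (B ⊂? V) ×-dec (V ⊂? ⊤)) (members 𝓐)
    ... | no  none = Tight.tight-balanced λ V∈ B⊂V V⊂⊤ → none (List.lose V∈ (B⊂V , V⊂⊤))
    ... | yes found with List.find found
    ... | V , V∈ , B⊂V , V⊂⊤ = Above.above-balanced V∈ B⊂V V⊂⊤

-- Comparing fractions of naturals by cross multiplication

-- `_/_` reduces its fraction, so the comparison passes to the unnormalised rationals, where the
-- reduced fraction is `≃` to the given one.
/-cancel-< : ∀ i j k l → (+ i / suc j) ℚ.< (+ k / suc l) → i * suc l < k * suc j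
/-cancel-< i j k l lt = ℤ.drop‿+<+ (subst₂ ℤ._<_ (sym (ℤ.pos-* i (suc l))) (sym (ℤ.pos-* k (suc j)))
  (ℚᵘ.drop-*<* (ℚᵘ.<-respˡ-≃ (ℚ.toℚᵘ-fromℚᵘ (mkℚᵘ (+ i) j)) (ℚᵘ.<-respʳ-≃ (ℚ.toℚᵘ-fromℚᵘ (mkℚᵘ (+ k) l)) (ℚ.toℚᵘ-mono-< lt)))))

/-mono-< : ∀ i j k l → i * suc l < k * suc j → (+ i / suc j) ℚ.< (+ k / suc l)
/-mono-< i j k l lt = ℚ.toℚᵘ-cancel-< (ℚᵘ.<-respˡ-≃ (ℚᵘ.≃-sym (ℚ.toℚᵘ-fromℚᵘ (mkℚᵘ (+ i) j)))
  (ℚᵘ.<-respʳ-≃ (ℚᵘ.≃-sym (ℚ.toℚᵘ-fromℚᵘ (mkℚᵘ (+ k) l)))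
    (*<* (subst₂ ℤ._<_ (ℤ.pos-* i (suc l)) (ℤ.pos-* k (suc j)) (ℤ.+<+ lt)))))

/-mono-≤ : ∀ i j k l → i * suc l ≤ k * suc j → (+ i / suc j) ℚ.≤ (+ k / suc l)
/-mono-≤ i j k l le = ℚ.toℚᵘ-cancel-≤ (ℚᵘ.≤-respˡ-≃ (ℚᵘ.≃-sym (ℚ.toℚᵘ-fromℚᵘ (mkℚᵘ (+ i) j)))
  (ℚᵘ.≤-respʳ-≃ (ℚᵘ.≃-sym (ℚ.toℚᵘ-fromℚᵘ (mkℚᵘ (+ k) l)))
    (*≤* (subst₂ ℤ._≤_ (ℤ.pos-* i (suc l)) (ℤ.pos-* k (suc j)) (ℤ.+≤+ le)))))

-- Small members and irredundance read off the definitions.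

∈-belowHalf⁻ : ∀ {𝓐 : Family n} {X} → X ∈ᶠ belowHalf 𝓐 → X ∈ᶠ 𝓐 × Small X
∈-belowHalf⁻ {n} {𝓐} {X} X∈ with ∈-filter⁻ (λ A → (+ ∣ A ∣ / 1) ℚ.<? (+ n / 2)) {xs = members 𝓐} X∈
... | X∈𝓐 , lt = X∈𝓐 , subst₂ _<_ (*-comm ∣ X ∣ 2) (*-identityʳ n) (/-cancel-< ∣ X ∣ 0 n 1 lt)

∈-belowHalf⁺ : ∀ {𝓐 : Family n} {X} → X ∈ᶠ 𝓐 → Small X → X ∈ᶠ belowHalf 𝓐
∈-belowHalf⁺ {n} {X = X} X∈ sm = ∈-filter⁺ (λ A → (+ ∣ A ∣ / 1) ℚ.<? (+ n / 2)) X∈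
  (/-mono-< ∣ X ∣ 0 n 1 (subst₂ _<_ (*-comm 2 ∣ X ∣) (sym (*-identityʳ n)) sm))

irr⁻ : ∀ {𝓢 : Family n} {S x} → x ∈ irr 𝓢 S → x ∈ S × (∀ {T} → T ∈ᶠ 𝓢 → T ≢ S → x ∉ T)
irr⁻ {𝓢 = 𝓢} {S} x∈ = p─q⊆p S _ x∈ , λ T∈ T≢S x∈T →
  x∈p─q⇒x∉q S _ x∈ (∈⇒⊆⋃ (∈-filter⁺ (λ T → ¬? (T ≟ˢ S)) T∈ T≢S) x∈T)

singleton : Subset n → Family n
singleton S = family (S ∷ []) ([] ∷ [])

singleton-irredundant : ∀ {S : Subset n} → Nonempty S → Irredundant (singleton S)
singleton-irredundant {S = S} (x , x∈S) (here refl) = x , x∈p∧x∉q⇒x∈p─q x∈S x∉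
  where
  x∉ : x ∉ b (remove S (singleton S))
  x∉ x∈ with ∈⋃⁻ _ x∈
  ... | T , T∈ , _ with ∈-filter⁻ (λ T → ¬? (T ≟ˢ S)) {xs = S ∷ []} T∈
  ... | here T≡S , T≢S = T≢S T≡S

-- Cases by the size of the minimum cover, and the average.

module _ {n : ℕ} (𝓐 : Family n) (uc : UnionClosed 𝓐) (full : HasFullBase 𝓐)
  (sep : Separating 𝓐) (height : HasHeight 𝓐 4) (4≤n : 4 ≤ n) where

  open Height4 𝓐 uc full sep height

  minimumCover⇒balanced : ∀ 𝓑 → IsMinimumCover 𝓐 𝓑 → size 𝓑 ≤ 2 → Balanced
  minimumCover⇒balanced 𝓑@(family Ss distinct𝓑) minCover ∣𝓑∣≤2 = by-size Ss refl
    where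
    open IsMinimumCover minCover
    open IsIrredundantCover isIrredundantCover

    small⊆⋃ : ∀ {X} → X ∈ᶠ 𝓐 → Small X → X ⊆ ⋃ Ss
    small⊆⋃ X∈ sm = subst (_ ∈_) (sym covers) ∘ ∈⇒⊆⋃ (∈-belowHalf⁺ {𝓐 = 𝓐} X∈ sm)

    by-size : ∀ Xs → Ss ≡ Xs → Balanced
    -- An empty cover leaves `⊥` as the only possible small member.
    by-size [] refl = unique-small⇒balanced ⊥ λ X∈ sm → ⊆-antisym (small⊆⋃ X∈ sm) ⊥⊆
    by-size (S ∷ []) refl with Any.any? (_⊂? S) (members 𝓐)
    ... | no  none = unique-small⇒balanced S small≡
      where
      small≡ : ∀ {X} → X ∈ᶠ 𝓐 → Small X → X ≡ S
      small≡ {X} X∈ sm = decidable-stable (X ≟ˢ S) λ X≢S →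
        none (List.lose X∈ (⊆∧≢⇒⊂ (subst (X ⊆_) (∪-identityʳ S) (small⊆⋃ X∈ sm)) X≢S))
    ... | yes found with List.find found | ∈-belowHalf⁻ {𝓐 = 𝓐} (subfamily (here refl)) | irredundant (here refl)
    ... | X₀ , X₀∈ , X₀⊂S | S∈ , S-small | x , x∈ =
      OneCover.oneCover-balanced S∈ S-small (x , proj₁ (irr⁻ {𝓢 = 𝓑} x∈))
        (λ {X} X∈ sm → subst (X ⊆_) (∪-identityʳ S) (small⊆⋃ X∈ sm)) X₀∈ X₀⊂S
    by-size (S ∷ T ∷ []) refl
      with ∈-belowHalf⁻ {𝓐 = 𝓐} (subfamily (here refl)) | ∈-belowHalf⁻ {𝓐 = 𝓐} (subfamily (there (here refl)))
         | irredundant (here refl) | irredundant (there (here refl))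
    ... | S∈ , S-small | T∈ , T-small | x , x∈ | y , y∈ =
      TwoCover.twoCover-balanced 4≤n S∈ T∈ S-small T-small
        -- Either inclusion contradicts irredundance: `x` belongs to `S` alone and `y` to `T` alone.
        (λ S⊆T → proj₂ (irr⁻ {𝓢 = 𝓑} x∈) (there (here refl)) (≢-sym S≢T) (S⊆T x∈S))
        (λ T⊆S → proj₂ (irr⁻ {𝓢 = 𝓑} y∈) (here refl) S≢T (T⊆S (proj₁ (irr⁻ {𝓢 = 𝓑} y∈))))
        -- Were `S ∪ T` small, it would form a cover with one set, against the minimum size 2.
        (λ sm → contradiction (minimum (singleton (S ∪ T)) (singleton-cover sm)) λ {(s≤s ())})
        (λ {X} X∈ sm → subst (X ⊆_) b≡ (small⊆⋃ X∈ sm))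
      where
      S≢T : S ≢ T
      S≢T = All.head (AllPairs.head distinct𝓑)
      x∈S : x ∈ S
      x∈S = proj₁ (irr⁻ {𝓢 = 𝓑} x∈)
      b≡ : S ∪ T ∪ ⊥ ≡ S ∪ T
      b≡ = cong (S ∪_) (∪-identityʳ T)
      singleton-cover : Small (S ∪ T) → IsIrredundantCover 𝓐 (singleton (S ∪ T))
      singleton-cover sm = record
        { subfamily   = λ {(here refl) → ∈-belowHalf⁺ {𝓐 = 𝓐} (UnionClosed.∪-closed uc S∈ T∈) sm}
        ; irredundant = singleton-irredundant (x , p⊆p∪q T x∈S)
        ; covers      = trans (∪-identityʳ (S ∪ T)) (trans (sym b≡) covers)
        }
    by-size (_ ∷ _ ∷ _ ∷ _) refl = contradiction ∣𝓑∣≤2 λ {(s≤s (s≤s ()))}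

Avg≥ : ∀ (𝓐 : Family n) .{{_ : NonZero (size 𝓐)}} → n * size 𝓐 ≤ 2 * ∑ ∣_∣ (members 𝓐) → Avg 𝓐 ≥ℚ (+ n / 2)
Avg≥ {n} (family Xs@(_ ∷ Ys) _) le = /-mono-≤ n 1 (∑ ∣_∣ Xs) (length Ys)
  (≤-trans le (≤-reflexive (*-comm 2 (∑ ∣_∣ Xs))))

theorem2p1 : (n h : ℕ) (𝓐 : Family n) (uc : UnionClosed 𝓐) → HasFullBase 𝓐 → Separating 𝓐 → HasHeight 𝓐 h →
    h ≡ 4 → 4 ≤ n →
    (𝓑 : Family n) → IsMinimumCover 𝓐 𝓑 → 0 ≤ size 𝓑 × size 𝓑 ≤ 2 →
    Avg 𝓐 {{UnionClosed⇒nonZero uc}} ≥ℚ (+ n / 2)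
theorem2p1 n _ 𝓐 uc full sep height refl 4≤n 𝓑 minCover (_ , ∣𝓑∣≤2) =
  Avg≥ 𝓐 {{UnionClosed⇒nonZero uc}} (∑deficit≤∑surplus⇒half≤average (members 𝓐)
    (minimumCover⇒balanced 𝓐 uc full sep height 4≤n 𝓑 minCover ∣𝓑∣≤2))
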